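{- There exists $\epsilon\in\mathbb{R}_{>0}$ such that for every sufficiently large $n\in\mathbb{N}$, every Sums-of-Squares (SOS) refutation of the Tseitin formula $\mathrm{TS}_n$ has monomial size at least $2^{\epsilon n}$.
   Context: Tseitin formulas: fix a family $\{G_n : n\in\mathbb{N}\}$ of constant-degree regular expander graphs, $G_n=(V,E)$ having $n$ vertices, where the degree $d$ is a constant. (Expander: there is a constant $\alpha>0$ such that in each $G_n$ every vertex set $U$ with $|U|\leq n/2$ has at least $\alpha|U|$ edges leaving it.) $\mathrm{TS}_n$ has one Boolean variable $x_e$ for each $e\in E$ and one parity constraint $\sum_{e: u\in e}x_e=1 \bmod 2$ for each $u\in V$ (when $d$ is even, this is unsatisfiable for odd $n$). It is encoded as the system of polynomial equations $\{\prod_{e: u\in e}(1-2x_e)=-1 : u\in V\}$. The constant $\epsilon$ may depend on the family. SOS proofs: with $N$ Boolean variables, polynomials are real polynomials in $2N$ commuting variables $x_1,\ldots,x_N,\bar{x}_1,\ldots,\bar{x}_N$ ($N$ pairs of twin variables); $B_N=\{x_i^2-x_i,\ \bar{x}_i^2-\bar{x}_i,\ x_i+\bar{x}_i-1 : i\in[N]\}$. Constraints $q_1\geq 0,\ldots,q_\ell\geq 0$, $p_1=0,\ldots,p_m=0$ form an indexed set $Q=\{q_1,\ldots,q_\ell,p_1,\ldots,p_m\}$ (an equation $f=g$ is identified with the polynomial $f-g$). An SOS refutation of (from) $Q$ is a formal identity $$-1=s_0+\sum_{j\in[\ell]}s_jq_j+\sum_{j\in[m]}t_jp_j+\sum_{q\in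 B_N}u_qq,$$ where each $s_j=\sum_{i=1}^{k_j}r_{i,j}^2$ is given as a sum of squares of polynomials ($j\in\{0\}\cup[\ell]$) and $t_j,u_q$ are arbitrary polynomials. Its monomial size is $\sum_{j\in\{0\}\cup[\ell]}\sum_{i=1}^{k_j}\mathrm{size}(r_{i,j})+\sum_{j\in[m]}\mathrm{size}(t_j)$, where $\mathrm{size}(p)$ is the number of (nonzero) terms of $p$. -}

module Defs where

open import Data.Fin using (Fin)
import Data.Fin.Subset as Subset
open Subset using (Subset; Nonempty; _∩_; ∁)
open import Data.Fin.Subset.Properties using (_∈?_; nonempty?)
open import Data.Integer using (+_)
open import Data.List
  using (List; []; _∷_; _++_; map; foldr; filter; length; tabulate; allFin; cartesianProductWith)
open import Data.Nat.ListAction using (sum)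
open import Data.List.Relation.Unary.All using (All)
open import Data.List.Relation.Unary.Unique.Propositional using (Unique)
open import Data.Nat as ℕ using (ℕ)
import Data.Nat.Properties as ℕₚ
open import Data.Product using (∃-syntax; _×_; _,_; proj₂)
import Data.Product.Properties as ×ₚ
open import Data.Rational as ℚ using (ℚ; 0ℚ; 1ℚ; ½)
import Data.Rational.Properties as ℚₚ
open import Data.Rational.Solver using (module +-*-Solver)
open import Data.Vec as Vec using (Vec)
import Data.Vec.Properties as Vecₚ
open import Function.Definitions using (Injective)
open import Level using (0ℓ)
open import Relation.Binary.Definitions using (DecidableEquality)
open import Relation.Binary.PropositionalEquality
  using (_≡_; refl; sym; trans; cong; subst)
open import Relation.Nullary using (¬_; yes; no; _×-dec_)
open import Relation.Unary using (Pred; _∈_)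

-- Real numbers are Cauchy sequences of rationals, with equality _≃ᴿ_.

CauchySeq : (ℕ → ℚ) → Set
CauchySeq x = ∀ ε → 0ℚ ℚ.< ε →
  ∃[ N ] (∀ m n → N ℕ.≤ m → N ℕ.≤ n → ℚ.∣ x m ℚ.- x n ∣ ℚ.< ε)

record ℝ : Set where
  constructor mkℝ
  field
    seq    : ℕ → ℚ
    cauchy : CauchySeq seq

open ℝ public

private
  module _ where
    open +-*-Solver

    +-rearrange : ∀ a b c d → (a ℚ.+ b) ℚ.- (c ℚ.+ d) ≡ (a ℚ.- c) ℚ.+ (b ℚ.- d)
    +-rearrange = solve 4 (λ a b c d → (a :+ b) :- (c :+ d) := (a :- c) :+ (b :- d)) refl

    *-rearrange : ∀ a b c d →
      a ℚ.* b ℚ.- c ℚ.* d ≡ a ℚ.* (b ℚ.- d) ℚ.+ d ℚ.* (a ℚ.- c)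
    *-rearrange = solve 4 (λ a b c d → a :* b :- c :* d := a :* (b :- d) :+ d :* (a :- c)) refl

    neg-rearrange : ∀ a b → (ℚ.- a) ℚ.- (ℚ.- b) ≡ ℚ.- (a ℚ.- b)
    neg-rearrange = solve 2 (λ a b → (:- a) :- (:- b) := :- (a :- b)) refl

    split : ∀ a b → a ≡ (a ℚ.- b) ℚ.+ b
    split = solve 2 (λ a b → a := (a :- b) :+ b) refl

    halves : ∀ ε → ½ ℚ.* ε ℚ.+ ½ ℚ.* ε ≡ ε
    halves = solve 1 (λ ε → con ½ :* ε :+ con ½ :* ε := ε) refl

    factor : ∀ B C δ → B ℚ.* δ ℚ.+ C ℚ.* δ ≡ (B ℚ.+ C) ℚ.* δ
    factor = solve 3 (λ B C δ → B :* δ :+ C :* δ := (B :+ C) :* δ) refl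

  0<½* : ∀ {ε} → 0ℚ ℚ.< ε → 0ℚ ℚ.< ½ ℚ.* ε
  0<½* {ε} ε>0 = ℚₚ.positive⁻¹ _ {{ℚₚ.pos*pos⇒pos ½ ε {{ℚ.positive ε>0}}}}

  divide : ∀ B ε → 0ℚ ℚ.< B → 0ℚ ℚ.< ε → ∃[ δ ] (0ℚ ℚ.< δ × B ℚ.* δ ≡ ε)
  divide B ε B>0 ε>0 = inv ℚ.* ε , δ>0 , Bδ≡ε
    where
    instance
      B⁺ : ℚ.Positive B
      B⁺ = ℚ.positive B>0
      B≢0 : ℚ.NonZero B
      B≢0 = ℚₚ.pos⇒nonZero B
      ε⁺ : ℚ.Positive ε
      ε⁺ = ℚ.positive ε>0
    inv : ℚ
    inv = ℚ.1/ B
    δ>0 : 0ℚ ℚ.< inv ℚ.* ε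
    δ>0 = ℚₚ.positive⁻¹ _ {{ℚₚ.pos*pos⇒pos inv {{ℚₚ.1/pos⇒pos B}} ε}}
    Bδ≡ε : B ℚ.* (inv ℚ.* ε) ≡ ε
    Bδ≡ε = trans (sym (ℚₚ.*-assoc B inv ε))
             (trans (cong (ℚ._* ε) (ℚₚ.*-inverseʳ B)) (ℚₚ.*-identityˡ ε))

  0<1 : 0ℚ ℚ.< 1ℚ
  0<1 = ℚₚ.positive⁻¹ 1ℚ

  bounded : ∀ x → CauchySeq x →
    ∃[ B ] ∃[ N ] (0ℚ ℚ.< B × (∀ n → N ℕ.≤ n → ℚ.∣ x n ∣ ℚ.< B))
  bounded x cx with cx 1ℚ 0<1
  ... | N , close = 1ℚ ℚ.+ ℚ.∣ x N ∣ , N ,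
        ℚₚ.+-mono-<-≤ 0<1 (ℚₚ.0≤∣p∣ (x N)) , bound
    where
    open ℚₚ.≤-Reasoning
    bound : ∀ n → N ℕ.≤ n → ℚ.∣ x n ∣ ℚ.< 1ℚ ℚ.+ ℚ.∣ x N ∣
    bound n N≤n = begin-strict
      ℚ.∣ x n ∣                         ≡⟨ cong ℚ.∣_∣ (split (x n) (x N)) ⟩
      ℚ.∣ (x n ℚ.- x N) ℚ.+ x N ∣       ≤⟨ ℚₚ.∣p+q∣≤∣p∣+∣q∣ (x n ℚ.- x N) (x N) ⟩
      ℚ.∣ x n ℚ.- x N ∣ ℚ.+ ℚ.∣ x N ∣   <⟨ ℚₚ.+-monoˡ-< ℚ.∣ x N ∣ (close n N N≤n ℕₚ.≤-refl) ⟩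
      1ℚ ℚ.+ ℚ.∣ x N ∣                  ∎

  ∣*∣< : ∀ {B δ} a b → 0ℚ ℚ.< B → ℚ.∣ a ∣ ℚ.< B → ℚ.∣ b ∣ ℚ.< δ → ℚ.∣ a ℚ.* b ∣ ℚ.< B ℚ.* δ
  ∣*∣< {B} {δ} a b B>0 a<B b<δ = begin-strict
    ℚ.∣ a ℚ.* b ∣        ≡⟨ ℚₚ.∣p*q∣≡∣p∣*∣q∣ a b ⟩
    ℚ.∣ a ∣ ℚ.* ℚ.∣ b ∣  ≤⟨ ℚₚ.*-monoʳ-≤-nonNeg ℚ.∣ b ∣ {{ℚ.nonNegative (ℚₚ.0≤∣p∣ b)}} (ℚₚ.<⇒≤ a<B) ⟩
    B ℚ.* ℚ.∣ b ∣        <⟨ ℚₚ.*-monoʳ-<-pos B {{ℚ.positive B>0}} b<δ ⟩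
    B ℚ.* δ              ∎
    where open ℚₚ.≤-Reasoning

  abstract
    +-cauchy : ∀ x y → CauchySeq x → CauchySeq y → CauchySeq (λ n → x n ℚ.+ y n)
    +-cauchy x y cx cy ε ε>0
      with cx (½ ℚ.* ε) (0<½* ε>0) | cy (½ ℚ.* ε) (0<½* ε>0)
    ... | M , closeˣ | N , closeʸ = M ℕ.⊔ N , λ m n m≥ n≥ → begin-strict
        ℚ.∣ (x m ℚ.+ y m) ℚ.- (x n ℚ.+ y n) ∣      ≡⟨ cong ℚ.∣_∣ (+-rearrange (x m) (y m) (x n) (y n)) ⟩
        ℚ.∣ (x m ℚ.- x n) ℚ.+ (y m ℚ.- y n) ∣      ≤⟨ ℚₚ.∣p+q∣≤∣p∣+∣q∣ (x m ℚ.- x n) (y m ℚ.- y n) ⟩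
        ℚ.∣ x m ℚ.- x n ∣ ℚ.+ ℚ.∣ y m ℚ.- y n ∣    <⟨ ℚₚ.+-mono-<
            (closeˣ m n (ℕₚ.m⊔n≤o⇒m≤o M N m≥) (ℕₚ.m⊔n≤o⇒m≤o M N n≥))
            (closeʸ m n (ℕₚ.m⊔n≤o⇒n≤o M N m≥) (ℕₚ.m⊔n≤o⇒n≤o M N n≥)) ⟩
        ½ ℚ.* ε ℚ.+ ½ ℚ.* ε                        ≡⟨ halves ε ⟩
        ε                                          ∎
      where open ℚₚ.≤-Reasoning

    neg-cauchy : ∀ x → CauchySeq x → CauchySeq (λ n → ℚ.- x n)
    neg-cauchy x cx ε ε>0 with cx ε ε>0
    ... | N , close = N , λ m n m≥ n≥ → begin-strict
        ℚ.∣ (ℚ.- x m) ℚ.- (ℚ.- x n) ∣  ≡⟨ cong ℚ.∣_∣ (neg-rearrange (x m) (x n)) ⟩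
        ℚ.∣ ℚ.- (x m ℚ.- x n) ∣        ≡⟨ ℚₚ.∣-p∣≡∣p∣ (x m ℚ.- x n) ⟩
        ℚ.∣ x m ℚ.- x n ∣              <⟨ close m n m≥ n≥ ⟩
        ε                              ∎
      where open ℚₚ.≤-Reasoning

    *-close : ∀ {B C δ ε} a b c d → 0ℚ ℚ.< B → 0ℚ ℚ.< C → (B ℚ.+ C) ℚ.* δ ≡ ε →
      ℚ.∣ a ∣ ℚ.< B → ℚ.∣ d ∣ ℚ.< C → ℚ.∣ b ℚ.- d ∣ ℚ.< δ → ℚ.∣ a ℚ.- c ∣ ℚ.< δ →
      ℚ.∣ a ℚ.* b ℚ.- c ℚ.* d ∣ ℚ.< ε
    *-close {B} {C} {δ} {ε} a b c d B>0 C>0 Bδ+Cδ≡ε a<B d<C b-d<δ a-c<δ = begin-strict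
      ℚ.∣ a ℚ.* b ℚ.- c ℚ.* d ∣
        ≡⟨ cong ℚ.∣_∣ (*-rearrange a b c d) ⟩
      ℚ.∣ a ℚ.* (b ℚ.- d) ℚ.+ d ℚ.* (a ℚ.- c) ∣
        ≤⟨ ℚₚ.∣p+q∣≤∣p∣+∣q∣ (a ℚ.* (b ℚ.- d)) (d ℚ.* (a ℚ.- c)) ⟩
      ℚ.∣ a ℚ.* (b ℚ.- d) ∣ ℚ.+ ℚ.∣ d ℚ.* (a ℚ.- c) ∣
        <⟨ ℚₚ.+-mono-< (∣*∣< a (b ℚ.- d) B>0 a<B b-d<δ) (∣*∣< d (a ℚ.- c) C>0 d<C a-c<δ) ⟩
      B ℚ.* δ ℚ.+ C ℚ.* δ
        ≡⟨ factor B C δ ⟩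
      (B ℚ.+ C) ℚ.* δ
        ≡⟨ Bδ+Cδ≡ε ⟩
      ε ∎
      where open ℚₚ.≤-Reasoning

    *-cauchy : ∀ x y → CauchySeq x → CauchySeq y → CauchySeq (λ n → x n ℚ.* y n)
    *-cauchy x y cx cy ε ε>0 =
      let B , K , B>0 , x<B = bounded x cx
          C , L , C>0 , y<C = bounded y cy
          δ , δ>0 , Bδ+Cδ≡ε = divide (B ℚ.+ C) ε (ℚₚ.+-mono-< B>0 C>0) ε>0
          M , closeˣ = cx δ δ>0
          N , closeʸ = cy δ δ>0
      in (K ℕ.⊔ L) ℕ.⊔ (M ℕ.⊔ N) , λ m n m≥ n≥ →
        let m≥KL = ℕₚ.m⊔n≤o⇒m≤o (K ℕ.⊔ L) (M ℕ.⊔ N) m≥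
            n≥KL = ℕₚ.m⊔n≤o⇒m≤o (K ℕ.⊔ L) (M ℕ.⊔ N) n≥
            m≥MN = ℕₚ.m⊔n≤o⇒n≤o (K ℕ.⊔ L) (M ℕ.⊔ N) m≥
            n≥MN = ℕₚ.m⊔n≤o⇒n≤o (K ℕ.⊔ L) (M ℕ.⊔ N) n≥
        in *-close (x m) (y m) (x n) (y n) B>0 C>0 Bδ+Cδ≡ε
             (x<B m (ℕₚ.m⊔n≤o⇒m≤o K L m≥KL))
             (y<C n (ℕₚ.m⊔n≤o⇒n≤o K L n≥KL))
             (closeʸ m n (ℕₚ.m⊔n≤o⇒n≤o M N m≥MN) (ℕₚ.m⊔n≤o⇒n≤o M N n≥MN))
             (closeˣ m n (ℕₚ.m⊔n≤o⇒m≤o M N m≥MN) (ℕₚ.m⊔n≤o⇒m≤o M N n≥MN))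

    const-cauchy : ∀ q → CauchySeq (λ _ → q)
    const-cauchy q ε ε>0 = 0 , λ _ _ _ _ →
      subst (ℚ._< ε) (sym (cong ℚ.∣_∣ (ℚₚ.+-inverseʳ q))) ε>0

infixl 7 _*ᴿ_
infixl 6 _+ᴿ_
infix  8 -ᴿ_
infix  4 _≃ᴿ_ _<ᴿ_ _≤ᴿ_

fromℚ : ℚ → ℝ
fromℚ q = mkℝ (λ _ → q) (const-cauchy q)

fromℕ : ℕ → ℝ
fromℕ n = fromℚ (+ n ℚ./ 1)

0ᴿ 1ᴿ : ℝ
0ᴿ = fromℚ 0ℚ
1ᴿ = fromℚ 1ℚ

_+ᴿ_ _*ᴿ_ : ℝ → ℝ → ℝ
mkℝ x cx +ᴿ mkℝ y cy = mkℝ (λ n → x n ℚ.+ y n) (+-cauchy x y cx cy)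
mkℝ x cx *ᴿ mkℝ y cy = mkℝ (λ n → x n ℚ.* y n) (*-cauchy x y cx cy)

-ᴿ_ : ℝ → ℝ
-ᴿ mkℝ x cx = mkℝ (λ n → ℚ.- x n) (neg-cauchy x cx)

_≃ᴿ_ _<ᴿ_ _≤ᴿ_ : ℝ → ℝ → Set
x ≃ᴿ y = ∀ ε → 0ℚ ℚ.< ε → ∃[ N ] (∀ n → N ℕ.≤ n → ℚ.∣ seq x n ℚ.- seq y n ∣ ℚ.< ε)
x <ᴿ y = ∃[ ε ] (0ℚ ℚ.< ε × ∃[ N ] (∀ n → N ℕ.≤ n → seq x n ℚ.+ ε ℚ.< seq y n))
x ≤ᴿ y = ¬ (y <ᴿ x)

-- For real x, 2^x = sup { 2^r : r ∈ ℚ, r < x }, so 2^x ≤ s holds iff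
-- 2^r ≤ s for every rational r < x.  Writing r = (a - c) / b with b ≥ 1,
-- r < x reads a < c + b x, and 2^r ≤ s reads 2^a ≤ 2^c s^b.
2^_≤_ : ℝ → ℕ → Set
2^ x ≤ s = ∀ a b c → 1 ℕ.≤ b →
  fromℕ a <ᴿ fromℕ c +ᴿ fromℕ b *ᴿ x → 2 ℕ.^ a ℕ.≤ 2 ℕ.^ c ℕ.* s ℕ.^ b

infix 4 2^_≤_

-- (α , β) is the monomial x^α x̄^β.
Monomial : ℕ → Set
Monomial N = Vec ℕ N × Vec ℕ N

_≟ᴹ_ : ∀ {N} → DecidableEquality (Monomial N)
_≟ᴹ_ = ×ₚ.≡-dec (Vecₚ.≡-dec ℕ._≟_) (Vecₚ.≡-dec ℕ._≟_)

𝟙 : ∀ {N} → Monomial N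
𝟙 = Vec.replicate _ 0 , Vec.replicate _ 0

_∙_ : ∀ {N} → Monomial N → Monomial N → Monomial N
(α , β) ∙ (α′ , β′) = Vec.zipWith ℕ._+_ α α′ , Vec.zipWith ℕ._+_ β β′

-- A polynomial expression: a finite sum of terms a · m, in which a monomial
-- may be repeated and coefficients may vanish.  Expressions denote the same
-- polynomial when they are related by _≈_.
Expr : ℕ → Set
Expr N = List (ℝ × Monomial N)

coeff : ∀ {N} → Expr N → Monomial N → ℝ
coeff []            m = 0ᴿ
coeff ((a , k) ∷ p) m with k ≟ᴹ m
... | yes _ = a +ᴿ coeff p m
... | no  _ = coeff p m

infix  4 _≈_
infixl 6 _⊕_ _⊖_
infixl 7 _⊗_

_≈_ : ∀ {N} → Expr N → Expr N → Set
p ≈ q = ∀ m → coeff p m ≃ᴿ coeff q m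

const : ∀ {N} → ℝ → Expr N
const a = (a , 𝟙) ∷ []

var twin : ∀ {N} → Fin N → Expr N
var  i = (1ᴿ , (Vec.replicate _ 0 Vec.[ i ]≔ 1 , Vec.replicate _ 0)) ∷ []
twin i = (1ᴿ , (Vec.replicate _ 0 , Vec.replicate _ 0 Vec.[ i ]≔ 1)) ∷ []

_⊕_ _⊖_ _⊗_ : ∀ {N} → Expr N → Expr N → Expr N
p ⊕ q = p ++ q
p ⊖ q = p ⊕ map (λ (a , m) → -ᴿ a , m) q
p ⊗ q = cartesianProductWith (λ (a , m) (b , k) → a *ᴿ b , m ∙ k) p q

∑ ∏ : ∀ {N} → List (Expr N) → Expr N
∑ = foldr _⊕_ []
∏ = foldr _⊗_ (const 1ᴿ)

-- A polynomial given by its nonzero terms, so that their number can be counted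
-- although equality on ℝ is undecidable.
record Polynomial (N : ℕ) : Set where
  field
    terms    : Expr N
    distinct : Unique (map proj₂ terms)
    nonzero  : All (λ (a , _) → ¬ (a ≃ᴿ 0ᴿ)) terms

open Polynomial public

size : ∀ {N} → Polynomial N → ℕ
size p = length (terms p)

data Axiom : Set where
  x²-x x̄²-x̄ x+x̄-1 : Axiom

axioms : List Axiom
axioms = x²-x ∷ x̄²-x̄ ∷ x+x̄-1 ∷ []

B : ∀ N → Fin N → Axiom → Expr N
B N i x²-x  = var i ⊗ var i ⊖ var i
B N i x̄²-x̄  = twin i ⊗ twin i ⊖ twin i
B N i x+x̄-1 = var i ⊕ twin i ⊖ const 1ᴿ

-- The constraints q j ≥ 0 (j ∈ [ℓ]) and p j = 0 (j ∈ [m]).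
record System (N : ℕ) : Set where
  field
    {ℓ m} : ℕ
    q     : Fin ℓ → Expr N
    p     : Fin m → Expr N

sumOfSquares : ∀ {N} → List (Polynomial N) → Expr N
sumOfSquares rs = ∑ (map (λ r → terms r ⊗ terms r) rs)

-- The identity -1 = s₀ + ∑ s_j q_j + ∑ t_j p_j + ∑ u_b b (b ∈ B N) of formal
-- polynomials.  The multipliers u do not count towards the size.
record Refutation {N : ℕ} (Q : System N) : Set where
  open System Q
  field
    r₀ : List (Polynomial N)
    r  : Fin ℓ → List (Polynomial N)
    t  : Fin m → Polynomial N
    u  : Fin N → Axiom → Polynomial N

    identity : const (-ᴿ 1ᴿ)
             ≈ sumOfSquares r₀
             ⊕ ∑ (tabulate λ j → sumOfSquares (r j) ⊗ q j)
             ⊕ ∑ (tabulate λ j → terms (t j) ⊗ p j)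
             ⊕ ∑ (tabulate λ i → ∑ (map (λ b → terms (u i b) ⊗ B N i b) axioms))

  monomialSize : ℕ
  monomialSize = sum (map size r₀)
           ℕ.+ sum (tabulate λ j → sum (map size (r j)))
           ℕ.+ sum (tabulate λ j → size (t j))

open Refutation public using (monomialSize)

-- Finite simple graphs on the vertex set Fin n; edges are two-element sets.
record Graph (n : ℕ) : Set where
  field
    ∣E∣            : ℕ
    edge           : Fin ∣E∣ → Subset n
    edge-size      : ∀ e → Subset.∣ edge e ∣ ≡ 2
    edge-injective : Injective _≡_ _≡_ edge

  incident : Fin n → List (Fin ∣E∣)
  incident u = filter (λ e → u ∈? edge e) (allFin ∣E∣)

  degree : Fin n → ℕ
  degree u = length (incident u)

  leaving : Subset n → List (Fin ∣E∣)
  leaving U =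
    filter (λ e → nonempty? (edge e ∩ U) ×-dec nonempty? (edge e ∩ ∁ U)) (allFin ∣E∣)

-- Only the graphs G n with n ∈ I count as members of the family: no simple
-- d-regular graph with d ≥ 1 has n = 1 vertices, nor any n ≤ d, nor odd n if
-- d is odd, so the conditions cannot be imposed at every n.
record ExpanderFamily : Set₁ where
  field
    I       : Pred ℕ 0ℓ
    G       : ∀ n → Graph n
    d       : ℕ
    regular : ∀ n → n ∈ I → ∀ u → Graph.degree (G n) u ≡ d
    α       : ℝ
    0<α     : 0ᴿ <ᴿ α
    expands : ∀ n → n ∈ I → ∀ (U : Subset n) → 2 ℕ.* Subset.∣ U ∣ ℕ.≤ n →
              α *ᴿ fromℕ Subset.∣ U ∣ ≤ᴿ fromℕ (length (Graph.leaving (G n) U))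

TS : ∀ {n} (H : Graph n) → System (Graph.∣E∣ H)
TS {n} H = record
  { ℓ = 0
  ; m = n
  ; q = λ ()
  ; p = λ u → ∏ (map (λ e → const 1ᴿ ⊖ const (fromℕ 2) ⊗ var e) (incident u))
              ⊖ const (-ᴿ 1ᴿ)
  }
  where open Graph H

{-# OPTIONS --safe #-}

-- Grigoriev's argument, made robust against large monomials.  For U with
-- 2 ∣U∣ ≤ n, adding up the parity constraints at the vertices of U forces
-- the character of the cut ∂U, i.e. ∏_{e ∈ ∂U} (1 - 2 x_e), to be (-1)^∣U∣.
-- By expansion, cuts with at most W edges come from sets of size O(W), so for
-- W = Ω(n) these forced values are consistent and multiplicative as long as
-- only sets of at most W edges are involved.  Declaring all other characters
-- to have expectation 0 gives a linear functional that is nonnegative on squares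
-- and vanishes on the constraints, in low degree.  If a refutation has fewer
-- than 2^j monomials, one greedily sets to 0 a literal occurring in a 1/q
-- fraction of the monomials with more than w free edges; each assignment costs
-- one unit of width, and j q of them leave no such monomial.  The functional
-- then applies to the restricted refutation and yields -1 ≥ 0.  Degrees of
-- the u_q do not matter, since the functional is defined on all functions on
-- the cube.  Everything is carried out over ℚ, at one sufficiently late index
-- of the Cauchy sequences of the coefficients.
module Submission where

open import Defs
open import Algebra.Bundles using (CommutativeRing)
open import Data.Bool using (Bool; true; false; not; _∧_; _xor_)
import Data.Bool.Properties as Boolₚ
open import Data.Fin using (Fin; zero; suc)
import Data.Fin.Properties as Finₚ
import Data.Fin.Subset as Subset
open Subset using (Subset; ⊥; ⁅_⁆; ∣_∣; inside; outside; _∩_; _∪_; _⊆_; ∁; Nonempty)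
import Data.Fin.Subset.Properties as Subsetₚ
open Subsetₚ using (_∈?_; anySubset?)
import Data.Integer as ℤ
import Data.Integer.Properties as ℤₚ
import Data.Integer.Solver as ℤ-Solver
open import Data.List as List using (List; []; _∷_; _++_; map; filter; length; foldr; concatMap; deduplicate; allFin)
import Data.List.Membership.Propositional as List∈
import Data.List.Membership.Propositional.Properties as List∈ₚ
import Data.List.Properties as Listₚ
open import Data.List.Relation.Unary.All as All using (All; []; _∷_)
import Data.List.Relation.Unary.All.Properties as Allₚ
open import Data.List.Relation.Unary.AllPairs using ([]; _∷_)
open import Data.List.Relation.Unary.Any using (here; there)
open import Data.List.Relation.Unary.Unique.DecPropositional.Properties using (deduplicate-!)
open import Data.List.Relation.Unary.Unique.Propositional using (Unique)
import Data.List.Relation.Unary.Unique.Propositional.Properties as Uniqueₚ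
open import Data.Maybe as Maybe using (Maybe; just; nothing; _<∣>_; is-nothing; fromMaybe)
import Data.Maybe.Properties as Maybeₚ
open import Data.Nat as ℕ using (ℕ; zero; suc; z≤n; s≤s)
open import Data.Nat.DivMod using (_/_; m/n*n≤m; m≡m%n+[m/n]*n; m%n<n; m≥n⇒m/n>0)
open import Data.Nat.ListAction using (sum)
import Data.Nat.Properties as ℕₚ
import Data.Nat.Solver as ℕ-Solver
open import Data.Product using (_,_; _×_; Σ-syntax; ∃-syntax; proj₁; proj₂)
open import Data.Rational as ℚ using (ℚ; 0ℚ; 1ℚ; ½)
import Data.Rational.Properties as ℚₚ
open import Data.Rational.Solver using (module +-*-Solver)
import Data.Rational.Unnormalised as ℚᵘ
import Data.Rational.Unnormalised.Properties as ℚᵘₚ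
open import Data.Sum using (inj₁; inj₂)
open import Data.Vec as Vec using (Vec; []; _∷_; lookup; tabulate; tail; zipWith)
import Data.Vec.Properties as Vecₚ
open import Function using (_∘_; id)
open import Level using (0ℓ)
open import Relation.Binary.PropositionalEquality
open import Relation.Nullary using (¬_; Dec; yes; no; contradiction; _×-dec_; ¬?; _→-dec_)
open import Relation.Nullary.Decidable using (decidable-stable)
open import Relation.Unary using (Decidable; Pred)
open import Algebra.Properties.CommutativeSemigroup ℕₚ.+-commutativeSemigroup using (x∙yz≈y∙xz; interchange)
open import Algebra.Properties.CommutativeSemigroup (CommutativeRing.+-commutativeSemigroup Boolₚ.xor-∧-commutativeRing) using () renaming (interchange to xor-interchange)

-- Turning a degree bound into a size bound usually meets the obstacle that a literal cannot always
-- be set to the value that kills it. Here a literal worth killing sits on an edge whose character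
-- is not forced, and such a character may be given either sign: the forced sets behave like a
-- subspace of F₂^E cut off at width W, and an unforced singleton is independent of it. So nothing
-- but width is paid. The same picture explains positivity: sets of at most w edges fall into
-- cosets, and the moment matrix has one rank-one block per coset.
--
-- The constants answer three demands. A heavy monomial has more than w free literals out of 2N, so
-- q w ≥ 2N makes some literal popular. The j q assignments use up j q units of width, and 2w must
-- remain for products of two characters; w = j q balances these at 3w. Last, comparing two vertex
-- sets with the same cut of at most W edges may involve 3 A W vertices, where A is an integer bound
-- on the inverse expansion, and these must not exceed n / 2. With q constant, j is a constant
-- fraction of n.

private
  variable
    N : ℕ
    X Y : Set

-- Parity reasoning and the elimination of heavy monomials

module _ where
  open import Data.Nat using (_+_; _*_; _^_; _≤_; _<_; _≤?_; _<?_; NonZero)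
  open Subset using (_∈_)

  infixr 6 _△_

  _△_ : Subset N → Subset N → Subset N
  _△_ = zipWith _xor_

  △-assoc : (S T U : Subset N) → (S △ T) △ U ≡ S △ T △ U
  △-assoc = Vecₚ.zipWith-assoc Boolₚ.xor-assoc

  △-comm : (S T : Subset N) → S △ T ≡ T △ S
  △-comm = Vecₚ.zipWith-comm Boolₚ.xor-comm

  △-identityˡ : (S : Subset N) → ⊥ △ S ≡ S
  △-identityˡ = Vecₚ.zipWith-identityˡ Boolₚ.xor-identityˡ

  △-identityʳ : (S : Subset N) → S △ ⊥ ≡ S
  △-identityʳ = Vecₚ.zipWith-identityʳ Boolₚ.xor-identityʳ

  △-self : (S : Subset N) → S △ S ≡ ⊥
  △-self []      = refl
  △-self (s ∷ S) = cong₂ _∷_ (Boolₚ.xor-same s) (△-self S)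

  △-cancelˡ : (S T : Subset N) → S △ S △ T ≡ T
  △-cancelˡ S T = trans (sym (△-assoc S S T)) (trans (cong (_△ T) (△-self S)) (△-identityˡ T))

  △-cancelʳ : (S T : Subset N) → (S △ T) △ T ≡ S
  △-cancelʳ S T = trans (△-assoc S T T) (trans (cong (S △_) (△-self T)) (△-identityʳ S))

  △-interchange : (S T U V : Subset N) → (S △ T) △ (U △ V) ≡ (S △ U) △ (T △ V)
  △-interchange S T U V = begin
    (S △ T) △ (U △ V)  ≡⟨ △-assoc S T (U △ V) ⟩
    S △ T △ U △ V      ≡⟨ cong (S △_) (sym (△-assoc T U V)) ⟩
    S △ (T △ U) △ V    ≡⟨ cong (λ X → S △ X △ V) (△-comm T U) ⟩
    S △ (U △ T) △ V    ≡⟨ cong (S △_) (△-assoc U T V) ⟩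
    S △ U △ T △ V      ≡⟨ sym (△-assoc S U (T △ V)) ⟩
    (S △ U) △ (T △ V)  ∎
    where open ≡-Reasoning

  △-telescope : (S T U : Subset N) → (S △ T) △ (T △ U) ≡ S △ U
  △-telescope S T U = trans (△-assoc S T (T △ U)) (cong (S △_) (△-cancelˡ T U))

  ∣△∣≤ : (S T : Subset N) → ∣ S △ T ∣ ≤ ∣ S ∣ + ∣ T ∣
  ∣△∣≤ []            []            = z≤n
  ∣△∣≤ (inside  ∷ S) (inside  ∷ T) = ℕₚ.m≤n⇒m≤1+n (ℕₚ.≤-trans (∣△∣≤ S T) (ℕₚ.+-monoʳ-≤ ∣ S ∣ (ℕₚ.n≤1+n _)))
  ∣△∣≤ (inside  ∷ S) (outside ∷ T) = s≤s (∣△∣≤ S T)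
  ∣△∣≤ (outside ∷ S) (inside  ∷ T) = ℕₚ.≤-trans (s≤s (∣△∣≤ S T)) (ℕₚ.≤-reflexive (sym (ℕₚ.+-suc ∣ S ∣ ∣ T ∣)))
  ∣△∣≤ (outside ∷ S) (outside ∷ T) = ∣△∣≤ S T

  ∣△⁅⁆∣≤ : (S : Subset N) (e : Fin N) → ∣ S △ ⁅ e ⁆ ∣ ≤ suc ∣ S ∣
  ∣△⁅⁆∣≤ S e = begin
    ∣ S △ ⁅ e ⁆ ∣        ≤⟨ ∣△∣≤ S ⁅ e ⁆ ⟩
    ∣ S ∣ + ∣ ⁅ e ⁆ ∣    ≡⟨ cong (∣ S ∣ +_) (Subsetₚ.∣⁅x⁆∣≡1 e) ⟩
    ∣ S ∣ + 1            ≡⟨ ℕₚ.+-comm ∣ S ∣ 1 ⟩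
    suc ∣ S ∣            ∎
    where open ℕₚ.≤-Reasoning

  ∣⊥∣≤ : ∀ {W} → ∣ ⊥ {N} ∣ ≤ W
  ∣⊥∣≤ {N} rewrite Subsetₚ.∣⊥∣≡0 N = z≤n

  -- K S ≡ just a says that the character y_S = ∏_{e ∈ S} (1 - 2 x_e) is forced to
  -- be (-1)^a by parity reasoning that only meets sets of at most W edges;
  -- K S ≡ nothing says that its pseudo-expectation is 0.
  record IsPseudoCharacter (W : ℕ) (K : Subset N → Maybe Bool) : Set where
    field
      K-⊥ : K ⊥ ≡ just false
      K-△ : ∀ {S T a b} → ∣ S ∣ ≤ W → ∣ T ∣ ≤ W → ∣ S △ T ∣ ≤ W →
            K S ≡ just a → K T ≡ just b → K (S △ T) ≡ just (a xor b)

  weaken : ∀ {V W} {K : Subset N → Maybe Bool} → V ≤ W → IsPseudoCharacter W K → IsPseudoCharacter V K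
  weaken V≤W K-isPC = record
    { K-⊥ = K-⊥
    ; K-△ = λ S≤ T≤ ST≤ → K-△ (ℕₚ.≤-trans S≤ V≤W) (ℕₚ.≤-trans T≤ V≤W) (ℕₚ.≤-trans ST≤ V≤W)
    }
    where open IsPseudoCharacter K-isPC

  _⊑_ : (K L : Subset N → Maybe Bool) → Set
  K ⊑ L = ∀ {S a} → K S ≡ just a → L S ≡ just a

  private
    xor-swap : ∀ x y z → x xor (y xor z) ≡ y xor (x xor z)
    xor-swap false y z = refl
    xor-swap true false z = refl
    xor-swap true true z = refl

    xor-cancel : ∀ x y z → (x xor y) xor (x xor z) ≡ y xor z
    xor-cancel false y z = refl
    xor-cancel true  y z = Boolₚ.xor-annihilates-not y z

  -- Adjoins the constraint y_e = (-1)^v: the forced sets gain their translates by `⁅ e ⁆`. Values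
  -- already forced by `K` take precedence, so that no earlier constraint is overwritten.
  module Extension {W : ℕ} {K : Subset N → Maybe Bool} (K-isPC : IsPseudoCharacter (suc W) K)
                   (e : Fin N) (v : Bool) where
    open IsPseudoCharacter K-isPC

    -- The width drops by one because K-△ is needed for sets enlarged by e.
    extend : Subset N → Maybe Bool
    extend S = K S <∣> Maybe.map (v xor_) (K (S △ ⁅ e ⁆))

    extend-old : K ⊑ extend
    extend-old {S} eq rewrite eq = refl

    private
      extend-new : ∀ {S b} → K S ≡ nothing → K (S △ ⁅ e ⁆) ≡ just b → extend S ≡ just (v xor b)
      extend-new {S} eq eq′ rewrite eq | eq′ = refl

      ≤suc : ∀ {m} → m ≤ W → m ≤ suc W
      ≤suc = ℕₚ.m≤n⇒m≤1+n

      +e≤ : ∀ S → ∣ S ∣ ≤ W → ∣ S △ ⁅ e ⁆ ∣ ≤ suc W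
      +e≤ S S≤ = ℕₚ.≤-trans (∣△⁅⁆∣≤ S e) (s≤s S≤)

      data Value (S : Subset N) : Bool → Set where
        old : ∀ {a} → K S ≡ just a → Value S a
        new : ∀ {b} → K S ≡ nothing → K (S △ ⁅ e ⁆) ≡ just b → Value S (v xor b)

      value : ∀ S {a} → extend S ≡ just a → Value S a
      value S eq with K S in eqS
      value S refl | just a = old eqS
      value S eq   | nothing with K (S △ ⁅ e ⁆) in eqSe
      value S refl | nothing | just b = new eqS eqSe

      -- `T` is forced only by way of `e`. Then `S △ T` cannot be forced by `K`, since T = S △ (S △
      -- T) would be forced too; its value therefore also goes by way of `e`.
      mixed : ∀ {S T a b} → ∣ S ∣ ≤ W → ∣ T ∣ ≤ W → ∣ S △ T ∣ ≤ W →
              K S ≡ just a → K T ≡ nothing → K (T △ ⁅ e ⁆) ≡ just b →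
              extend (S △ T) ≡ just (a xor (v xor b))
      mixed {S} {T} {a} {b} S≤ T≤ ST≤ KS KT KTe =
        trans (extend-new KST KSTe) (cong just (xor-swap v a b))
        where
        KST : K (S △ T) ≡ nothing
        KST with K (S △ T) in eq
        ... | nothing = refl
        ... | just c with trans (sym KT) (trans (cong K (sym (△-cancelˡ S T)))
                            (K-△ (≤suc S≤) (≤suc ST≤) (subst (λ X → ∣ X ∣ ≤ suc W) (sym (△-cancelˡ S T)) (≤suc T≤)) KS eq))
        ... | ()
        KSTe : K ((S △ T) △ ⁅ e ⁆) ≡ just (a xor b)
        KSTe = trans (cong K (△-assoc S T ⁅ e ⁆))
          (K-△ (≤suc S≤) (+e≤ T T≤) (subst (λ X → ∣ X ∣ ≤ suc W) (△-assoc S T ⁅ e ⁆) (+e≤ (S △ T) ST≤)) KS KTe)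

    extend-isPC : IsPseudoCharacter W extend
    extend-isPC = record { K-⊥ = extend-old K-⊥ ; K-△ = extend-△ }
      where
      extend-△ : ∀ {S T a b} → ∣ S ∣ ≤ W → ∣ T ∣ ≤ W → ∣ S △ T ∣ ≤ W →
                 extend S ≡ just a → extend T ≡ just b → extend (S △ T) ≡ just (a xor b)
      extend-△ {S} {T} S≤ T≤ ST≤ KS KT with value S KS | value T KT
      ... | old p   | old q = extend-old (K-△ (≤suc S≤) (≤suc T≤) (≤suc ST≤) p q)
      ... | old p   | new q q′ = mixed S≤ T≤ ST≤ p q q′
      ... | new {a} p p′ | old {b} q = begin
        extend (S △ T)            ≡⟨ cong extend (△-comm S T) ⟩
        extend (T △ S)            ≡⟨ mixed T≤ S≤ (subst (λ X → ∣ X ∣ ≤ W) (△-comm S T) ST≤) q p p′ ⟩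
        just (b xor (v xor a))    ≡⟨ cong just (Boolₚ.xor-comm b (v xor a)) ⟩
        just ((v xor a) xor b)    ∎
        where open ≡-Reasoning
      -- The two translations by `⁅ e ⁆` cancel, and so do the two copies of `v`: `K` alone forces
      -- the sum.
      ... | new {a} p p′ | new {b} q q′ = extend-old (begin
        K (S △ T)                            ≡⟨ cong K (sym ST) ⟩
        K ((S △ ⁅ e ⁆) △ (T △ ⁅ e ⁆))        ≡⟨ K-△ (+e≤ S S≤) (+e≤ T T≤) (subst (λ X → ∣ X ∣ ≤ suc W) (sym ST) (≤suc ST≤)) p′ q′ ⟩
        just (a xor b)                       ≡⟨ cong just (sym (xor-cancel v a b)) ⟩
        just ((v xor a) xor (v xor b))       ∎)
        where
        open ≡-Reasoning
        ST : (S △ ⁅ e ⁆) △ (T △ ⁅ e ⁆) ≡ S △ T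
        ST = trans (△-interchange S ⁅ e ⁆ T ⁅ e ⁆)
               (trans (cong ((S △ T) △_) (△-self ⁅ e ⁆)) (△-identityʳ (S △ T)))

    extend-⁅⁆ : K ⁅ e ⁆ ≡ nothing → extend ⁅ e ⁆ ≡ just v
    extend-⁅⁆ eq = trans (extend-new eq (trans (cong K (△-self ⁅ e ⁆)) K-⊥)) (cong just (Boolₚ.xor-identityʳ v))

  -- Counting occurrences in lists

  occurrences : (X → Subset N) → List X → Fin N → ℕ
  occurrences f xs e = length (filter (λ x → e ∈? f x) xs)

  private
    total : (X → Subset N) → List X → ℕ
    total f xs = sum (map (λ x → ∣ f x ∣) xs)

    total-0 : (f : X → Subset 0) (xs : List X) → total f xs ≡ 0
    total-0 f []       = refl
    total-0 f (x ∷ xs) with f x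
    ... | [] = total-0 f xs

    total-suc : (f : X → Subset (suc N)) (xs : List X) →
                total f xs ≡ occurrences f xs zero + total (tail ∘ f) xs
    total-suc f []       = refl
    total-suc f (x ∷ xs) with f x
    ... | inside  ∷ p = cong suc (trans (cong (∣ p ∣ +_) (total-suc f xs)) (x∙yz≈y∙xz ∣ p ∣ (occurrences f xs zero) (total (tail ∘ f) xs)))
    ... | outside ∷ p = trans (cong (∣ p ∣ +_) (total-suc f xs)) (x∙yz≈y∙xz ∣ p ∣ (occurrences f xs zero) (total (tail ∘ f) xs))

    occurrences-suc : (f : X → Subset (suc N)) (xs : List X) (e : Fin N) →
                      occurrences (tail ∘ f) xs e ≡ occurrences f xs (suc e)
    occurrences-suc f []       e = refl
    occurrences-suc f (x ∷ xs) e with f x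
    ... | s ∷ p with e ∈? p
    ...   | yes _ = cong suc (occurrences-suc f xs e)
    ...   | no  _ = occurrences-suc f xs e

  -- Double counting.
  ∑∣∣≤ : ∀ q h (f : X → Subset N) (xs : List X) →
         (∀ e → q * occurrences f xs e ≤ h) → q * sum (map (λ x → ∣ f x ∣) xs) ≤ N * h
  ∑∣∣≤ {N = zero}  q h f xs bound rewrite total-0 f xs | ℕₚ.*-zeroʳ q = z≤n
  ∑∣∣≤ {N = suc N} q h f xs bound = begin
    q * total f xs                                        ≡⟨ cong (q *_) (total-suc f xs) ⟩
    q * (occurrences f xs zero + total (tail ∘ f) xs)     ≡⟨ ℕₚ.*-distribˡ-+ q (occurrences f xs zero) _ ⟩
    q * occurrences f xs zero + q * total (tail ∘ f) xs   ≤⟨ ℕₚ.+-mono-≤ (bound zero) (∑∣∣≤ q h (tail ∘ f) xs (λ e →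
        subst (λ k → q * k ≤ h) (sym (occurrences-suc f xs e)) (bound (suc e)))) ⟩
    h + N * h ∎
    where open ℕₚ.≤-Reasoning

  -- Two disjoint parts of the elements satisfying `P` are counted. In `step` they are the monomials
  -- that stay heavy and the heavy ones that contain the popular literal.
  length-filter-drop : {P P′ Q : Pred X 0ℓ} (P? : Decidable P) (P′? : Decidable P′) (Q? : Decidable Q) →
    (∀ {x} → P′ x → P x × ¬ Q x) → (xs : List X) →
    length (filter P′? xs) + length (filter Q? (filter P? xs)) ≤ length (filter P? xs)
  length-filter-drop P? P′? Q? imp [] = z≤n
  length-filter-drop P? P′? Q? imp (x ∷ xs) with ih ← length-filter-drop P? P′? Q? imp xs | P′? x | P? x
  ... | yes p′ | no ¬p = contradiction (proj₁ (imp p′)) ¬p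
  ... | no  _  | no _  = ih
  ... | yes p′ | yes _ with Q? x
  ...   | yes q = contradiction q (proj₂ (imp p′))
  ...   | no  _ = s≤s ih
  length-filter-drop P? P′? Q? imp (x ∷ xs) | no _ | yes _ with Q? x
  ...   | yes _ = ℕₚ.≤-trans (ℕₚ.≤-reflexive (ℕₚ.+-suc _ _)) (s≤s ih)
  ...   | no  _ = ℕₚ.m≤n⇒m≤1+n ih

  filter-none⁻ : {P : Pred X 0ℓ} (P? : Decidable P) (xs : List X) →
                 length (filter P? xs) ≡ 0 → All (λ x → ¬ P x) xs
  filter-none⁻ P? []       _  = []
  filter-none⁻ P? (x ∷ xs) eq with P? x
  ... | no ¬p = ¬p ∷ filter-none⁻ P? xs eq

  ∣∪∣≤ : (S T : Subset N) → ∣ S ∪ T ∣ ≤ ∣ S ∣ + ∣ T ∣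
  ∣∪∣≤ []            []            = z≤n
  ∣∪∣≤ (inside  ∷ S) (inside  ∷ T) = s≤s (ℕₚ.≤-trans (∣∪∣≤ S T) (ℕₚ.+-monoʳ-≤ ∣ S ∣ (ℕₚ.n≤1+n _)))
  ∣∪∣≤ (inside  ∷ S) (outside ∷ T) = s≤s (∣∪∣≤ S T)
  ∣∪∣≤ (outside ∷ S) (inside  ∷ T) = ℕₚ.≤-trans (s≤s (∣∪∣≤ S T)) (ℕₚ.≤-reflexive (sym (ℕₚ.+-suc ∣ S ∣ ∣ T ∣)))
  ∣∪∣≤ (outside ∷ S) (outside ∷ T) = ∣∪∣≤ S T

  -- Free literals and heavy monomials

  nonzero? : ℕ → Bool
  nonzero? zero    = false
  nonzero? (suc _) = true

  -- The indices i such that x_i (for true) or its twin (for false) divides the monomial.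
  literals : Bool → Monomial N → Subset N
  literals true  (α , β) = Vec.map nonzero? α
  literals false (α , β) = Vec.map nonzero? β

  free : (Subset N → Maybe Bool) → Subset N
  free K = tabulate λ e → is-nothing (K ⁅ e ⁆)

  ∈-free⁺ : (K : Subset N → Maybe Bool) {e : Fin N} → K ⁅ e ⁆ ≡ nothing → e ∈ free K
  ∈-free⁺ K {e} eq = Vecₚ.lookup⇒[]= e (free K) (trans (Vecₚ.lookup∘tabulate _ e) (cong is-nothing eq))

  ∈-free⁻ : (K : Subset N → Maybe Bool) {e : Fin N} → e ∈ free K → K ⁅ e ⁆ ≡ nothing
  ∈-free⁻ K {e} e∈ with trans (sym (Vecₚ.lookup∘tabulate _ e)) (Vecₚ.[]=⇒lookup e∈)
  ... | eq with K ⁅ e ⁆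
  ... | nothing = refl

  free-anti : (K L : Subset N → Maybe Bool) → K ⊑ L → free L ⊆ free K
  free-anti K L K⊑L {e} e∈ with K ⁅ e ⁆ in eq
  ... | nothing = ∈-free⁺ K eq
  ... | just a with trans (sym (K⊑L eq)) (∈-free⁻ L e∈)
  ...   | ()

  freeLiterals : (Subset N → Maybe Bool) → Bool → Monomial N → Subset N
  freeLiterals K b m = free K ∩ literals b m

  -- A monomial is alive when no literal in it is forced to 0.
  Alive : (Subset N → Maybe Bool) → Monomial N → Set
  Alive K m = ∀ b e → e ∈ literals b m → K ⁅ e ⁆ ≢ just (not b)

  -- An edge that occurs both as x_e and as its twin counts twice, because literals and not edges
  -- get killed. The sum still bounds the number of free edges, so an alive monomial that is not
  -- heavy depends on at most `w` edges after the restriction.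
  Heavy : ℕ → (Subset N → Maybe Bool) → Monomial N → Set
  Heavy w K m = Alive K m × w < ∣ freeLiterals K true m ∣ + ∣ freeLiterals K false m ∣

  alive? : (K : Subset N → Maybe Bool) → Decidable (Alive K)
  alive? K m with Finₚ.all? (ok? true) | Finₚ.all? (ok? false)
    where
    ok? : ∀ b e → Dec (e ∈ literals b m → K ⁅ e ⁆ ≢ just (not b))
    ok? b e = (e ∈? literals b m) →-dec ¬? (Maybeₚ.≡-dec Boolₚ._≟_ (K ⁅ e ⁆) (just (not b)))
  ... | yes p | yes q = yes λ { true → p ; false → q }
  ... | no ¬p | _     = no λ alive → ¬p (alive true)
  ... | yes _ | no ¬q = no λ alive → ¬q (alive false)

  heavy? : ∀ w (K : Subset N → Maybe Bool) → Decidable (Heavy w K)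
  heavy? w K m = alive? K m ×-dec (w <? _)

  heavy-anti : ∀ w (K L : Subset N → Maybe Bool) → K ⊑ L → ∀ {m} → Heavy w L m → Heavy w K m
  heavy-anti w K L K⊑L {m} (alive , w<) =
    (λ b e e∈ eq → alive b e e∈ (K⊑L eq)) ,
    ℕₚ.<-≤-trans w< (ℕₚ.+-mono-≤ (mono true) (mono false))
    where
    mono : ∀ b → ∣ freeLiterals L b m ∣ ≤ ∣ freeLiterals K b m ∣
    mono b = Subsetₚ.p⊆q⇒∣p∣≤∣q∣ λ e∈ →
      let e∈L , e∈m = Subsetₚ.x∈p∩q⁻ (free L) (literals b m) e∈
      in Subsetₚ.x∈p∩q⁺ (free-anti K L K⊑L e∈L , e∈m)

  module Elimination {N : ℕ} (q w : ℕ) (q>0 : 0 < q) (2N≤qw : 2 * N ≤ q * w) (ms : List (Monomial N)) where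

    heavies : (Subset N → Maybe Bool) → List (Monomial N)
    heavies K = filter (heavy? w K) ms

    private
      sum-+ : (f g : X → ℕ) (xs : List X) →
              sum (map (λ x → f x + g x) xs) ≡ sum (map f xs) + sum (map g xs)
      sum-+ f g []       = refl
      sum-+ f g (x ∷ xs) = trans (cong (f x + g x +_) (sum-+ f g xs))
        (interchange (f x) (g x) (sum (map f xs)) (sum (map g xs)))

      sum-≥ : (f : X → ℕ) (k : ℕ) {xs : List X} → All (λ x → k ≤ f x) xs → length xs * k ≤ sum (map f xs)
      sum-≥ f k []       = z≤n
      sum-≥ f k (p ∷ ps) = ℕₚ.+-mono-≤ p (sum-≥ f k ps)

    -- Averaging: `suc h` heavy monomials contain more than w (h + 1) free literals, which are
    -- spread over 2N ≤ q w candidates. The factor `q` stays on the right to avoid division.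
    popular : ∀ K {h} → length (heavies K) ≡ suc h →
              ∃[ b ] ∃[ e ] suc h ≤ q * occurrences (freeLiterals K b) (heavies K) e
    popular K {h} eq with search true | search false
      where
      search : ∀ b → Dec (∃[ e ] suc h ≤ q * occurrences (freeLiterals K b) (heavies K) e)
      search b = Finₚ.any? λ e → suc h ≤? _
    ... | yes (e , p) | _           = true , e , p
    ... | no _        | yes (e , p) = false , e , p
    ... | no none     | no none′    = contradiction impossible (ℕₚ.<-irrefl refl)
      where
      open ℕₚ.≤-Reasoning
      hs = heavies K
      F : Bool → Monomial N → ℕ
      F b m = ∣ freeLiterals K b m ∣
      bound : ∀ b → ¬ (∃[ e ] suc h ≤ q * occurrences (freeLiterals K b) hs e) →
              q * sum (map (F b) hs) ≤ N * h
      bound b none = ∑∣∣≤ q h (freeLiterals K b) hs λ e → ℕₚ.≤-pred (ℕₚ.≰⇒> λ p → none (e , p))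
      impossible : q * w * h < q * w * h
      impossible = begin-strict
        q * w * h                                          ≤⟨ ℕₚ.*-monoʳ-≤ (q * w) (ℕₚ.n≤1+n h) ⟩
        q * w * suc h                                      <⟨ ℕₚ.m<n+m _ (ℕₚ.*-mono-≤ q>0 (s≤s (z≤n {h}))) ⟩
        q * suc h + q * w * suc h                          ≡⟨ solve 3 (λ q w h → q :* (con 1 :+ h) :+ q :* w :* (con 1 :+ h)
                                                                := q :* ((con 1 :+ h) :* (con 1 :+ w))) refl q w h ⟩
        q * (suc h * suc w)                                ≡⟨ cong (λ k → q * (k * suc w)) (sym eq) ⟩
        q * (length hs * suc w)                            ≤⟨ ℕₚ.*-monoʳ-≤ q (sum-≥ (λ m → F true m + F false m) (suc w)
                                                                (All.map proj₂ (Allₚ.all-filter (heavy? w K) ms))) ⟩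
        q * sum (map (λ m → F true m + F false m) hs)      ≡⟨ cong (q *_) (sum-+ (F true) (F false) hs) ⟩
        q * (sum (map (F true) hs) + sum (map (F false) hs)) ≡⟨ ℕₚ.*-distribˡ-+ q (sum (map (F true) hs)) _ ⟩
        q * sum (map (F true) hs) + q * sum (map (F false) hs) ≤⟨ ℕₚ.+-mono-≤ (bound true none) (bound false none′) ⟩
        N * h + N * h                                      ≡⟨ solve 2 (λ N h → N :* h :+ N :* h := con 2 :* N :* h) refl N h ⟩
        2 * N * h                                          ≤⟨ ℕₚ.*-monoˡ-≤ h 2N≤qw ⟩
        q * w * h ∎
        where open ℕ-Solver.+-*-Solver

    -- Killing the popular literal removes at least a 1/q fraction. As the number h′ of remaining
    -- ones is itself at most q times the number of those killed, the loss can be written without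
    -- subtraction as (q + 1) h′ ≤ q h.
    step : ∀ {W} K → IsPseudoCharacter (suc W) K →
           ∃[ K′ ] (IsPseudoCharacter W K′ × K ⊑ K′ ×
                    suc q * length (heavies K′) ≤ q * length (heavies K))
    step {W} K K-isPC with length (heavies K) in eq
    -- Nothing is left to kill, yet one unit of width is given up, so that every step has the same
    -- price.
    ... | zero = K , weaken (ℕₚ.n≤1+n W) K-isPC , (λ p → p) ,
                 ℕₚ.≤-reflexive (trans (cong (suc q *_) eq) (trans (ℕₚ.*-zeroʳ (suc q)) (sym (ℕₚ.*-zeroʳ q))))
    ... | suc h with popular K eq
    ...   | b , e , p = extend , extend-isPC , extend-old , (begin
            h′ + q * h′                                   ≤⟨ ℕₚ.+-monoˡ-≤ (q * h′) (ℕₚ.≤-trans (ℕₚ.m≤m+n h′ _) (ℕₚ.≤-trans fewer (ℕₚ.≤-reflexive eq))) ⟩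
            suc h + q * h′                                ≤⟨ ℕₚ.+-monoˡ-≤ (q * h′) p ⟩
            q * killed + q * h′                           ≡⟨ sym (ℕₚ.*-distribˡ-+ q killed h′) ⟩
            q * (killed + h′)                             ≤⟨ ℕₚ.*-monoʳ-≤ q (ℕₚ.≤-trans (ℕₚ.≤-reflexive (ℕₚ.+-comm killed h′)) fewer) ⟩
            q * length (heavies K)                        ≡⟨ cong (q *_) eq ⟩
            q * suc h                                     ∎)
      where
      open ℕₚ.≤-Reasoning
      -- x_e (`b` true) vanishes at x_e = 0 and its twin at x_e = 1: in both cases the killing value
      -- is `not b`.
      open Extension K-isPC e (not b)
      h′ killed : ℕ
      h′ = length (heavies extend)
      killed = occurrences (freeLiterals K b) (heavies K) e
      -- A literal on a forced edge is never a free literal, so its count is 0 and `p` would read h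
      -- + 1 ≤ 0. This freedom is what permits the killing value.
      e-free : K ⁅ e ⁆ ≡ nothing
      e-free with K ⁅ e ⁆ in Ke
      ... | nothing = refl
      ... | just _ = contradiction p (subst (λ k → ¬ (suc h ≤ q * k)) (sym killed≡0)
                       (subst (λ k → ¬ (suc h ≤ k)) (sym (ℕₚ.*-zeroʳ q)) λ ()))
        where
        killed≡0 : killed ≡ 0
        killed≡0 = cong length (Listₚ.filter-none (λ m → e ∈? freeLiterals K b m)
          (All.universal (λ m e∈ → nothing≢just (∈-free⁻ K (proj₁ (Subsetₚ.x∈p∩q⁻ (free K) (literals b m) e∈)))) (heavies K)))
          where
          nothing≢just : K ⁅ e ⁆ ≢ nothing
          nothing≢just q with trans (sym Ke) q
          ... | ()
      fewer : h′ + killed ≤ length (heavies K)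
      fewer = length-filter-drop (heavy? w K) (heavy? w extend) (λ m → e ∈? freeLiterals K b m)
        (λ {m} heavy′ → heavy-anti w K extend extend-old heavy′ ,
          λ e∈ → proj₁ heavy′ b e (proj₂ (Subsetₚ.x∈p∩q⁻ (free K) (literals b m) e∈)) (extend-⁅⁆ e-free)) ms

    -- Each step removes a 1/q fraction, so after q steps at most half are left.
    steps : ∀ i {W} K → IsPseudoCharacter (i + W) K →
            ∃[ K′ ] (IsPseudoCharacter W K′ × K ⊑ K′ ×
                     (i + q) * length (heavies K′) ≤ q * length (heavies K))
    steps zero    K K-isPC = K , K-isPC , (λ p → p) , ℕₚ.≤-refl
    steps (suc i) K K-isPC with step K K-isPC
    ... | K₁ , K₁-isPC , K⊑K₁ , p with steps i K₁ K₁-isPC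
    ...   | K₂ , K₂-isPC , K₁⊑K₂ , r = K₂ , K₂-isPC , (λ eq → K₁⊑K₂ (K⊑K₁ eq)) , (begin
            -- Bernoulli's inequality (1 + 1/q)^i ≥ 1 + i/q with denominators cleared. The first
            -- summand uses h₂ ≤ h₁, obtained from `r` by dropping `i` and cancelling `q`.
            h₂ + (i + q) * h₂  ≤⟨ ℕₚ.+-mono-≤ (ℕₚ.*-cancelˡ-≤ q (ℕₚ.≤-trans (ℕₚ.*-monoˡ-≤ h₂ (ℕₚ.m≤n+m q i)) r)) r ⟩
            h₁ + q * h₁        ≤⟨ p ⟩
            q * length (heavies K) ∎)
      where
      open ℕₚ.≤-Reasoning
      instance
        q≢0 : NonZero q
        q≢0 = ℕ.>-nonZero q>0
      h₁ = length (heavies K₁)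
      h₂ = length (heavies K₂)

    phases : ∀ j {W} K → IsPseudoCharacter (j * q + W) K →
             ∃[ K′ ] (IsPseudoCharacter W K′ × K ⊑ K′ ×
                      2 ^ j * length (heavies K′) ≤ length (heavies K))
    phases zero    K K-isPC = K , K-isPC , (λ p → p) , ℕₚ.≤-reflexive (ℕₚ.+-identityʳ _)
    phases (suc j) {W} K K-isPC with steps q K (subst (λ V → IsPseudoCharacter V K) (ℕₚ.+-assoc q (j * q) W) K-isPC)
    ... | K₁ , K₁-isPC , K⊑K₁ , p with phases j K₁ K₁-isPC
    ...   | K₂ , K₂-isPC , K₁⊑K₂ , r = K₂ , K₂-isPC , (λ eq → K₁⊑K₂ (K⊑K₁ eq)) , (begin
            2 ^ suc j * h₂      ≡⟨ ℕₚ.*-assoc 2 (2 ^ j) h₂ ⟩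
            2 * (2 ^ j * h₂)    ≤⟨ ℕₚ.*-monoʳ-≤ 2 r ⟩
            2 * h₁              ≤⟨ ℕₚ.*-cancelˡ-≤ q (ℕₚ.≤-trans (ℕₚ.≤-reflexive (solve 2 (λ q h → q :* (con 2 :* h) := (q :+ q) :* h) refl q h₁)) p) ⟩
            length (heavies K)  ∎)
      where
      open ℕₚ.≤-Reasoning
      open ℕ-Solver.+-*-Solver
      instance
        q≢0 : NonZero q
        q≢0 = ℕ.>-nonZero q>0
      h₁ = length (heavies K₁)
      h₂ = length (heavies K₂)

    elimination : ∀ j {W} K → IsPseudoCharacter (j * q + W) K → length ms < 2 ^ j →
                  ∃[ K′ ] (IsPseudoCharacter W K′ × K ⊑ K′ × All (λ m → ¬ Heavy w K′ m) ms)
    elimination j K K-isPC few with phases j K K-isPC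
    ... | K′ , K′-isPC , K⊑K′ , p = K′ , K′-isPC , K⊑K′ , filter-none⁻ (heavy? w K′) ms no-heavies
      where
      open ℕₚ.≤-Reasoning
      no-heavies : length (heavies K′) ≡ 0
      no-heavies = ℕₚ.n<1⇒n≡0 (ℕₚ.*-cancelˡ-< (2 ^ j) (length (heavies K′)) 1 (begin-strict
        2 ^ j * length (heavies K′)  ≤⟨ p ⟩
        length (heavies K)           ≤⟨ Listₚ.length-filter (heavy? w K) ms ⟩
        length ms                    <⟨ few ⟩
        2 ^ j                        ≡⟨ sym (ℕₚ.*-identityʳ (2 ^ j)) ⟩
        2 ^ j * 1                    ∎))

-- Pseudo-expectations

module _ where
  open import Data.Rational using (_+_; _*_; _-_; -_; _≤_; _<_)
  open Subset using (_∈_)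

  sgn : Bool → ℚ
  sgn false = 1ℚ
  sgn true  = - 1ℚ

  sgn-xor : ∀ a b → sgn (a xor b) ≡ sgn a * sgn b
  sgn-xor false b     = sym (ℚₚ.*-identityˡ (sgn b))
  sgn-xor true  false = refl
  sgn-xor true  true  = refl

  χ : Maybe Bool → ℚ
  χ nothing  = 0ℚ
  χ (just a) = sgn a

  character : Subset N → Vec Bool N → ℚ
  character []      []      = 1ℚ
  character (s ∷ S) (b ∷ z) = sgn (s ∧ b) * character S z

  character-⊥ : (z : Vec Bool N) → character ⊥ z ≡ 1ℚ
  character-⊥ []      = refl
  character-⊥ (b ∷ z) = trans (ℚₚ.*-identityˡ _) (character-⊥ z)

  character-△ : (S T : Subset N) (z : Vec Bool N) → character (S △ T) z ≡ character S z * character T z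
  character-△ []      []      []      = refl
  character-△ (s ∷ S) (t ∷ T) (b ∷ z) = begin
    sgn ((s xor t) ∧ b) * character (S △ T) z
      ≡⟨ cong₂ _*_ (trans (cong sgn (Boolₚ.∧-distribʳ-xor b s t)) (sgn-xor (s ∧ b) (t ∧ b))) (character-△ S T z) ⟩
    (sgn (s ∧ b) * sgn (t ∧ b)) * (character S z * character T z)
      ≡⟨ solve 4 (λ a b c d → (a :* b) :* (c :* d) := (a :* c) :* (b :* d)) refl
           (sgn (s ∧ b)) (sgn (t ∧ b)) (character S z) (character T z) ⟩
    (sgn (s ∧ b) * character S z) * (sgn (t ∧ b) * character T z) ∎
    where
    open ≡-Reasoning
    open +-*-Solver

  character-⁅⁆ : (e : Fin N) (z : Vec Bool N) → character ⁅ e ⁆ z ≡ sgn (lookup z e)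
  character-⁅⁆ zero    (b ∷ z) = trans (cong (sgn b *_) (character-⊥ z)) (ℚₚ.*-identityʳ (sgn b))
  character-⁅⁆ (suc e) (b ∷ z) = trans (ℚₚ.*-identityˡ _) (character-⁅⁆ e z)

  -- The linear functional on functions on the cube taking the character of S to k S:
  -- each coordinate is split by f = (f₀ + f₁) / 2 + (-1)^b (f₀ - f₁) / 2.
  𝔼 : (Subset N → ℚ) → (Vec Bool N → ℚ) → ℚ
  𝔼 {zero}  k f = k [] * f []
  𝔼 {suc N} k f = 𝔼 (k ∘ (outside ∷_)) (λ z → ½ * (f (false ∷ z) + f (true ∷ z)))
                + 𝔼 (k ∘ (inside  ∷_)) (λ z → ½ * (f (false ∷ z) - f (true ∷ z)))

  𝔼-cong : (k : Subset N → ℚ) {f g : Vec Bool N → ℚ} → (∀ z → f z ≡ g z) → 𝔼 k f ≡ 𝔼 k g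
  𝔼-cong {zero}  k eq = cong (k [] *_) (eq [])
  𝔼-cong {suc N} k eq = cong₂ _+_
    (𝔼-cong _ λ z → cong₂ (λ a b → ½ * (a + b)) (eq (false ∷ z)) (eq (true ∷ z)))
    (𝔼-cong _ λ z → cong₂ (λ a b → ½ * (a - b)) (eq (false ∷ z)) (eq (true ∷ z)))

  𝔼-linear : (k : Subset N → ℚ) (a b : ℚ) (f g : Vec Bool N → ℚ) →
             𝔼 k (λ z → a * f z + b * g z) ≡ a * 𝔼 k f + b * 𝔼 k g
  𝔼-linear {zero}  k a b f g =
    solve 5 (λ k a b f g → k :* (a :* f :+ b :* g) := a :* (k :* f) :+ b :* (k :* g)) refl
      (k []) a b (f []) (g [])
    where open +-*-Solver
  𝔼-linear {suc N} k a b f g = begin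
    𝔼 _ (λ z → ½ * ((a * f (false ∷ z) + b * g (false ∷ z)) + (a * f (true ∷ z) + b * g (true ∷ z))))
      + 𝔼 _ (λ z → ½ * ((a * f (false ∷ z) + b * g (false ∷ z)) - (a * f (true ∷ z) + b * g (true ∷ z))))
      ≡⟨ cong₂ _+_ (𝔼-cong _ λ z → solve 6 (λ a b p q r s → con ½ :* ((a :* p :+ b :* q) :+ (a :* r :+ b :* s))
                                           := a :* (con ½ :* (p :+ r)) :+ b :* (con ½ :* (q :+ s))) refl
                       a b (f (false ∷ z)) (g (false ∷ z)) (f (true ∷ z)) (g (true ∷ z)))
                   (𝔼-cong _ λ z → solve 6 (λ a b p q r s → con ½ :* ((a :* p :+ b :* q) :- (a :* r :+ b :* s))
                                           := a :* (con ½ :* (p :- r)) :+ b :* (con ½ :* (q :- s))) refl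
                       a b (f (false ∷ z)) (g (false ∷ z)) (f (true ∷ z)) (g (true ∷ z))) ⟩
    𝔼 _ (λ z → a * f⁺ z + b * g⁺ z) + 𝔼 _ (λ z → a * f⁻ z + b * g⁻ z)
      ≡⟨ cong₂ _+_ (𝔼-linear _ a b f⁺ g⁺) (𝔼-linear _ a b f⁻ g⁻) ⟩
    (a * 𝔼 _ f⁺ + b * 𝔼 _ g⁺) + (a * 𝔼 _ f⁻ + b * 𝔼 _ g⁻)
      ≡⟨ solve 6 (λ a b p q r s → (a :* p :+ b :* q) :+ (a :* r :+ b :* s) := a :* (p :+ r) :+ b :* (q :+ s)) refl
           a b (𝔼 _ f⁺) (𝔼 _ g⁺) (𝔼 _ f⁻) (𝔼 _ g⁻) ⟩
    a * (𝔼 _ f⁺ + 𝔼 _ f⁻) + b * (𝔼 _ g⁺ + 𝔼 _ g⁻) ∎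
    where
    open ≡-Reasoning
    open +-*-Solver
    f⁺ f⁻ g⁺ g⁻ : Vec Bool N → ℚ
    f⁺ z = ½ * (f (false ∷ z) + f (true ∷ z))
    f⁻ z = ½ * (f (false ∷ z) - f (true ∷ z))
    g⁺ z = ½ * (g (false ∷ z) + g (true ∷ z))
    g⁻ z = ½ * (g (false ∷ z) - g (true ∷ z))

  𝔼-+ : (k : Subset N → ℚ) (f g : Vec Bool N → ℚ) → 𝔼 k (λ z → f z + g z) ≡ 𝔼 k f + 𝔼 k g
  𝔼-+ k f g = begin
    𝔼 k (λ z → f z + g z)              ≡⟨ 𝔼-cong k (λ z → sym (cong₂ _+_ (ℚₚ.*-identityˡ (f z)) (ℚₚ.*-identityˡ (g z)))) ⟩
    𝔼 k (λ z → 1ℚ * f z + 1ℚ * g z)    ≡⟨ 𝔼-linear k 1ℚ 1ℚ f g ⟩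
    1ℚ * 𝔼 k f + 1ℚ * 𝔼 k g            ≡⟨ cong₂ _+_ (ℚₚ.*-identityˡ (𝔼 k f)) (ℚₚ.*-identityˡ (𝔼 k g)) ⟩
    𝔼 k f + 𝔼 k g ∎
    where open ≡-Reasoning

  𝔼-* : (k : Subset N → ℚ) (a : ℚ) (f : Vec Bool N → ℚ) → 𝔼 k (λ z → a * f z) ≡ a * 𝔼 k f
  𝔼-* k a f = begin
    𝔼 k (λ z → a * f z)              ≡⟨ 𝔼-cong k (λ z → sym (trans (cong (a * f z +_) (ℚₚ.*-zeroˡ (f z))) (ℚₚ.+-identityʳ _))) ⟩
    𝔼 k (λ z → a * f z + 0ℚ * f z)   ≡⟨ 𝔼-linear k a 0ℚ f f ⟩
    a * 𝔼 k f + 0ℚ * 𝔼 k f           ≡⟨ trans (cong (a * 𝔼 k f +_) (ℚₚ.*-zeroˡ (𝔼 k f))) (ℚₚ.+-identityʳ _) ⟩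
    a * 𝔼 k f ∎
    where open ≡-Reasoning

  𝔼-0 : (k : Subset N → ℚ) → 𝔼 k (λ _ → 0ℚ) ≡ 0ℚ
  𝔼-0 k = trans (𝔼-* k 0ℚ (λ _ → 0ℚ)) (ℚₚ.*-zeroˡ (𝔼 k λ _ → 0ℚ))

  𝔼-character : (k : Subset N → ℚ) (S : Subset N) → 𝔼 k (character S) ≡ k S
  𝔼-character {zero}  k []            = ℚₚ.*-identityʳ (k [])
  𝔼-character {suc N} k (outside ∷ S) = begin
    𝔼 k⁺ (λ z → ½ * (1ℚ * character S z + 1ℚ * character S z)) + 𝔼 k⁻ (λ z → ½ * (1ℚ * character S z - 1ℚ * character S z))
      ≡⟨ cong₂ _+_ (𝔼-cong k⁺ λ z → solve 1 (λ c → con ½ :* (con 1ℚ :* c :+ con 1ℚ :* c) := c) refl (character S z))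
                   (𝔼-cong k⁻ λ z → solve 1 (λ c → con ½ :* (con 1ℚ :* c :- con 1ℚ :* c) := con 0ℚ) refl (character S z)) ⟩
    𝔼 k⁺ (character S) + 𝔼 k⁻ (λ _ → 0ℚ)   ≡⟨ cong₂ _+_ (𝔼-character k⁺ S) (𝔼-0 k⁻) ⟩
    k (outside ∷ S) + 0ℚ                 ≡⟨ ℚₚ.+-identityʳ (k (outside ∷ S)) ⟩
    k (outside ∷ S) ∎
    where
    open ≡-Reasoning
    open +-*-Solver
    k⁺ k⁻ : Subset N → ℚ
    k⁺ S = k (outside ∷ S)
    k⁻ S = k (inside ∷ S)
  𝔼-character {suc N} k (inside ∷ S) = begin
    𝔼 k⁺ (λ z → ½ * (1ℚ * character S z + - 1ℚ * character S z)) + 𝔼 k⁻ (λ z → ½ * (1ℚ * character S z - (- 1ℚ * character S z)))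
      ≡⟨ cong₂ _+_ (𝔼-cong k⁺ λ z → solve 1 (λ c → con ½ :* (con 1ℚ :* c :+ con (- 1ℚ) :* c) := con 0ℚ) refl (character S z))
                   (𝔼-cong k⁻ λ z → solve 1 (λ c → con ½ :* (con 1ℚ :* c :- con (- 1ℚ) :* c) := c) refl (character S z)) ⟩
    𝔼 k⁺ (λ _ → 0ℚ) + 𝔼 k⁻ (character S)   ≡⟨ cong₂ _+_ (𝔼-0 k⁺) (𝔼-character k⁻ S) ⟩
    0ℚ + k (inside ∷ S)                  ≡⟨ ℚₚ.+-identityˡ (k (inside ∷ S)) ⟩
    k (inside ∷ S) ∎
    where
    open ≡-Reasoning
    open +-*-Solver
    k⁺ k⁻ : Subset N → ℚ
    k⁺ S = k (outside ∷ S)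
    k⁻ S = k (inside ∷ S)

  -- Weighted sums and signed quadratic forms

  Σ* : List (ℚ × X) → (X → ℚ) → ℚ
  Σ* []            f = 0ℚ
  Σ* ((a , i) ∷ L) f = a * f i + Σ* L f

  Σ*-cong : (L : List (ℚ × X)) {f g : X → ℚ} → (∀ i → f i ≡ g i) → Σ* L f ≡ Σ* L g
  Σ*-cong []            eq = refl
  Σ*-cong ((a , i) ∷ L) eq = cong₂ (λ x y → a * x + y) (eq i) (Σ*-cong L eq)

  Σ*-++ : (L M : List (ℚ × X)) (f : X → ℚ) → Σ* (L ++ M) f ≡ Σ* L f + Σ* M f
  Σ*-++ []            M f = sym (ℚₚ.+-identityˡ _)
  Σ*-++ ((a , i) ∷ L) M f = trans (cong (a * f i +_) (Σ*-++ L M f)) (sym (ℚₚ.+-assoc (a * f i) (Σ* L f) (Σ* M f)))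

  Σ*-scale : (c : ℚ) (L : List (ℚ × X)) (f : X → ℚ) → Σ* (map (λ (a , i) → c * a , i) L) f ≡ c * Σ* L f
  Σ*-scale c []            f = sym (ℚₚ.*-zeroʳ c)
  Σ*-scale c ((a , i) ∷ L) f = trans (cong (c * a * f i +_) (Σ*-scale c L f))
    (solve 4 (λ c a x y → c :* a :* x :+ c :* y := c :* (a :* x :+ y)) refl c a (f i) (Σ* L f))
    where open +-*-Solver

  Σ*-rename : (g : Y → X) (L : List (ℚ × Y)) (f : X → ℚ) → Σ* (map (λ (a , j) → a , g j) L) f ≡ Σ* L (f ∘ g)
  Σ*-rename g []            f = refl
  Σ*-rename g ((a , j) ∷ L) f = cong (a * f (g j) +_) (Σ*-rename g L f)

  Σ*-* : (c : ℚ) (L : List (ℚ × X)) (f : X → ℚ) → Σ* L (λ i → c * f i) ≡ c * Σ* L f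
  Σ*-* c []            f = sym (ℚₚ.*-zeroʳ c)
  Σ*-* c ((a , i) ∷ L) f = trans (cong (a * (c * f i) +_) (Σ*-* c L f))
    (solve 4 (λ c a x y → a :* (c :* x) :+ c :* y := c :* (a :* x :+ y)) refl c a (f i) (Σ* L f))
    where open +-*-Solver

  Σ*-0 : (L : List (ℚ × X)) {f : X → ℚ} → (∀ i → f i ≡ 0ℚ) → Σ* L f ≡ 0ℚ
  Σ*-0 []            eq = refl
  Σ*-0 ((a , i) ∷ L) eq = trans (cong₂ (λ x y → a * x + y) (eq i) (Σ*-0 L eq)) (trans (ℚₚ.+-identityʳ _) (ℚₚ.*-zeroʳ a))

  𝔼-Σ* : (k : Subset N → ℚ) (L : List (ℚ × X)) (f : X → Vec Bool N → ℚ) →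
         𝔼 k (λ z → Σ* L (λ i → f i z)) ≡ Σ* L (λ i → 𝔼 k (f i))
  𝔼-Σ* k []            f = 𝔼-0 k
  𝔼-Σ* k ((a , i) ∷ L) f = trans (𝔼-+ k (λ z → a * f i z) (λ z → Σ* L (λ i → f i z)))
    (cong₂ _+_ (𝔼-* k a (f i)) (𝔼-Σ* k L f))

  0≤² : ∀ p → 0ℚ ≤ p * p
  0≤² p with ℚₚ.≤-total 0ℚ p
  ... | inj₁ 0≤p = ℚₚ.nonNegative⁻¹ (p * p) {{ℚₚ.nonNeg*nonNeg⇒nonNeg p {{ℚ.nonNegative 0≤p}} p {{ℚ.nonNegative 0≤p}}}}
  ... | inj₂ p≤0 = ℚₚ.nonNegative⁻¹ (p * p) {{ℚₚ.nonPos*nonPos⇒nonPos p {{ℚ.nonPositive p≤0}} p {{ℚ.nonPositive p≤0}}}}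

  0≤+ : ∀ {p q} → 0ℚ ≤ p → 0ℚ ≤ q → 0ℚ ≤ p + q
  0≤+ = ℚₚ.+-mono-≤

  -- κ i j ≡ just a relates i and j with sign (-1)^a; the quadratic form of such a
  -- signed equivalence relation is a sum of one square per class.
  module SignedEquivalence (κ : X → X → Maybe Bool)
    (κ-refl : ∀ i → κ i i ≡ just false)
    (κ-sym : ∀ i j → κ i j ≡ κ j i)
    (κ-trans : ∀ {i j k a b} → κ i j ≡ just a → κ j k ≡ just b → κ i k ≡ just (a xor b)) where

    form : List (ℚ × X) → ℚ
    form L = Σ* L (λ i → Σ* L (λ j → χ (κ i j)))

    private
      Unrelated : X → ℚ × X → Set
      Unrelated h (_ , i) = κ h i ≡ nothing

      unrelated? : ∀ h t → Dec (Unrelated h t)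
      unrelated? h (_ , i) with κ h i
      ... | nothing = yes refl
      ... | just _  = no λ ()

      κ-unrelated : ∀ {h i j b} → κ h i ≡ nothing → κ h j ≡ just b → κ i j ≡ nothing
      κ-unrelated {h} {i} {j} hi hj with κ i j in eq
      ... | nothing = refl
      ... | just c with trans (sym hi) (κ-trans hj (trans (κ-sym j i) eq))
      ...   | ()

      row-related : ∀ {h i a} → κ h i ≡ just a → ∀ j → χ (κ i j) ≡ sgn a * χ (κ h j)
      row-related {h} {i} {a} hi j with κ h j in hj
      ... | just b = trans (cong χ (κ-trans (trans (κ-sym i h) hi) hj)) (sgn-xor a b)
      ... | nothing with κ i j in ij
      ...   | nothing = sym (ℚₚ.*-zeroʳ (sgn a))
      ...   | just c with trans (sym hj) (κ-trans hi ij)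
      ...     | ()

      row-unrelated : ∀ {h i} → κ h i ≡ nothing → ∀ L →
        Σ* L (λ j → χ (κ i j)) ≡ Σ* (filter (unrelated? h) L) (λ j → χ (κ i j))
      row-unrelated hi [] = refl
      row-unrelated {h} {i} hi ((a , j) ∷ L) with κ h j in hj
      ... | nothing = cong (a * χ (κ i j) +_) (row-unrelated hi L)
      ... | just b  = begin
        a * χ (κ i j) + row L  ≡⟨ cong₂ (λ x y → a * χ x + y) (κ-unrelated hi hj) (row-unrelated hi L) ⟩
        a * 0ℚ + row U         ≡⟨ cong (_+ row U) (ℚₚ.*-zeroʳ a) ⟩
        0ℚ + row U             ≡⟨ ℚₚ.+-identityˡ (row U) ⟩
        row U                  ∎
        where
        open ≡-Reasoning
        U = filter (unrelated? h) L
        row : List (ℚ × X) → ℚ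
        row M = Σ* M (λ j → χ (κ i j))

      -- Rows in the class of `h` are ± the row of `h`; the other rows vanish on the columns of that
      -- class. The class thus contributes a product of two sums, which becomes a square for M = L.
      -- Keeping `M` apart from `L` is what lets the induction run over rows only.
      split-form : ∀ h L M → let U = filter (unrelated? h) L in
        Σ* M (λ i → Σ* L (λ j → χ (κ i j)))
          ≡ Σ* M (λ i → χ (κ h i)) * Σ* L (λ j → χ (κ h j))
          + Σ* (filter (unrelated? h) M) (λ i → Σ* U (λ j → χ (κ i j)))
      split-form h L [] = sym (trans (ℚₚ.+-identityʳ _) (ℚₚ.*-zeroˡ (Σ* L (λ j → χ (κ h j)))))
      split-form h L ((a , i) ∷ M) with κ h i in hi
      ... | nothing = trans (cong₂ (λ x y → a * x + y) (row-unrelated hi L) (split-form h L M))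
        (solve 5 (λ a r s t u → a :* r :+ (s :* t :+ u) := (a :* con 0ℚ :+ s) :* t :+ (a :* r :+ u)) refl a _ _ _ _)
        where open +-*-Solver
      ... | just b = trans (cong₂ (λ x y → a * x + y)
            (trans (Σ*-cong L (row-related hi)) (Σ*-* (sgn b) L (λ j → χ (κ h j)))) (split-form h L M))
        (solve 5 (λ a b s t u → a :* (b :* t) :+ (s :* t :+ u) := (a :* b :+ s) :* t :+ u) refl a (sgn b) _ _ _)
        where open +-*-Solver

      form≥0′ : ∀ n L → length L ℕ.≤ n → 0ℚ ≤ form L
      form≥0′ n       []            _       = ℚₚ.≤-refl
      form≥0′ (suc n) L@((a , h) ∷ L′) (s≤s len) =
        subst (0ℚ ≤_) (sym (split-form h L L))
          (0≤+ (0≤² (Σ* L (λ i → χ (κ h i)))) (form≥0′ n (filter (unrelated? h) L) shorter))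
        where
        -- By reflexivity `h` belongs to its own class, so the filter drops at least the head.
        shorter : length (filter (unrelated? h) L) ℕ.≤ n
        shorter rewrite κ-refl h = ℕₚ.≤-trans (Listₚ.length-filter (unrelated? h) L′) len

    form≥0 : ∀ L → 0ℚ ≤ form L
    form≥0 L = form≥0′ (length L) L ℕₚ.≤-refl

  -- Functions of low degree on the cube

  Low : ℕ → ℕ → Set
  Low N w = Σ[ S ∈ Subset N ] ∣ S ∣ ℕ.≤ w

  lowCharacter : ∀ {w} → Low N w → Vec Bool N → ℚ
  lowCharacter (S , _) = character S

  LowDegree : ℕ → (Vec Bool N → ℚ) → Set
  LowDegree {N} w f = ∃[ L ] (∀ z → f z ≡ Σ* {X = Low N w} L (λ S → lowCharacter S z))

  _DependsOn_ : (Vec Bool N → ℚ) → Subset N → Set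
  f DependsOn A = ∀ z z′ → (∀ e → e ∈ A → lookup z e ≡ lookup z′ e) → f z ≡ f z′

  private
    restrict : {A : Subset N} {f : Vec Bool (suc N) → ℚ} → f DependsOn (inside ∷ A) →
               ∀ b → (f ∘ (b ∷_)) DependsOn A
    restrict dep b z z′ agree = dep (b ∷ z) (b ∷ z′) λ { zero _ → refl ; (suc e) (Vec.there e∈) → agree e e∈ }

  -- The Fourier expansion of `f` lives on subsets of `A`: a coordinate in `A` splits `f` into its
  -- even and odd parts, and one outside `A` may be frozen at `false`.
  lowDegree : ∀ {w} (A : Subset N) → ∣ A ∣ ℕ.≤ w → (f : Vec Bool N → ℚ) → f DependsOn A → LowDegree w f
  lowDegree [] _ f dep = ((f [] , ([] , z≤n)) ∷ []) , λ { [] → sym (trans (ℚₚ.+-identityʳ (f [] * 1ℚ)) (ℚₚ.*-identityʳ (f []))) }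
  lowDegree {suc N} (outside ∷ A) ≤w f dep
    with L , eq ← lowDegree A ≤w (f ∘ (false ∷_)) (λ z z′ agree → dep (false ∷ z) (false ∷ z′)
                    λ { zero () ; (suc e) (Vec.there e∈) → agree e e∈ })
    = map (λ (a , S) → a , out S) L , λ { (b ∷ z) → begin
        f (b ∷ z)                         ≡⟨ dep (b ∷ z) (false ∷ z) (λ { zero () ; (suc e) _ → refl }) ⟩
        f (false ∷ z)                     ≡⟨ eq z ⟩
        Σ* L (λ S → lowCharacter S z)     ≡⟨ Σ*-cong L (λ S → sym (ℚₚ.*-identityˡ (lowCharacter S z))) ⟩
        Σ* L (λ S → lowCharacter (out S) (b ∷ z))
                                          ≡⟨ sym (Σ*-rename out L (λ S → lowCharacter S (b ∷ z))) ⟩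
        Σ* (map (λ (a , S) → a , out S) L) (λ S → lowCharacter S (b ∷ z)) ∎ }
    where
    open ≡-Reasoning
    out : ∀ {v} → Low N v → Low (suc N) v
    out (S , p) = outside ∷ S , p
  lowDegree {suc N} {suc w} (inside ∷ A) (s≤s ≤w) f dep
    with L , eq ← lowDegree A ≤w (λ z → ½ * (f (false ∷ z) + f (true ∷ z)))
                    (λ z z′ agree → cong₂ (λ p q → ½ * (p + q)) (restrict dep false z z′ agree) (restrict dep true z z′ agree))
       | M , eq′ ← lowDegree A ≤w (λ z → ½ * (f (false ∷ z) - f (true ∷ z)))
                    (λ z z′ agree → cong₂ (λ p q → ½ * (p - q)) (restrict dep false z z′ agree) (restrict dep true z z′ agree))
    = map (λ (a , S) → a , out S) L ++ map (λ (a , S) → a , inn S) M , λ { (b ∷ z) → begin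
        f (b ∷ z)
          ≡⟨ split b z ⟩
        ½ * (f (false ∷ z) + f (true ∷ z)) + sgn b * (½ * (f (false ∷ z) - f (true ∷ z)))
          ≡⟨ cong₂ (λ p q → p + sgn b * q) (eq z) (eq′ z) ⟩
        Σ* L (λ S → lowCharacter S z) + sgn b * Σ* M (λ S → lowCharacter S z)
          ≡⟨ cong₂ _+_ (Σ*-cong L (λ S → sym (ℚₚ.*-identityˡ (lowCharacter S z))))
                       (sym (Σ*-* (sgn b) M (λ S → lowCharacter S z))) ⟩
        Σ* L (λ S → lowCharacter (out S) (b ∷ z)) + Σ* M (λ S → lowCharacter (inn S) (b ∷ z))
          ≡⟨ sym (cong₂ _+_ (Σ*-rename out L (λ S → lowCharacter S (b ∷ z)))
                            (Σ*-rename inn M (λ S → lowCharacter S (b ∷ z)))) ⟩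
        Σ* (map (λ (a , S) → a , out S) L) (λ S → lowCharacter S (b ∷ z))
          + Σ* (map (λ (a , S) → a , inn S) M) (λ S → lowCharacter S (b ∷ z))
          ≡⟨ sym (Σ*-++ (map (λ (a , S) → a , out S) L) (map (λ (a , S) → a , inn S) M) (λ S → lowCharacter S (b ∷ z))) ⟩
        Σ* (map (λ (a , S) → a , out S) L ++ map (λ (a , S) → a , inn S) M) (λ S → lowCharacter S (b ∷ z)) ∎ }
    where
    open ≡-Reasoning
    out inn : Low N w → Low (suc N) (suc w)
    out (S , p) = outside ∷ S , ℕₚ.m≤n⇒m≤1+n p
    inn (S , p) = inside ∷ S , s≤s p
    split : ∀ b z → f (b ∷ z) ≡ ½ * (f (false ∷ z) + f (true ∷ z)) + sgn b * (½ * (f (false ∷ z) - f (true ∷ z)))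
    split false z = solve 2 (λ p q → p := con ½ :* (p :+ q) :+ con 1ℚ :* (con ½ :* (p :- q))) refl (f (false ∷ z)) (f (true ∷ z))
      where open +-*-Solver
    split true z = solve 2 (λ p q → q := con ½ :* (p :+ q) :+ con (- 1ℚ) :* (con ½ :* (p :- q))) refl (f (false ∷ z)) (f (true ∷ z))
      where open +-*-Solver

  -- Values of polynomial expressions at 0/1-points

  bit : Bool → ℚ
  bit false = 0ℚ
  bit true  = 1ℚ

  bitPower : Bool → ℕ → ℚ
  bitPower b zero    = 1ℚ
  bitPower b (suc k) = bit b * bitPower b k

  bitPower-+ : ∀ b j k → bitPower b (j ℕ.+ k) ≡ bitPower b j * bitPower b k
  bitPower-+ b zero    k = sym (ℚₚ.*-identityˡ _)
  bitPower-+ b (suc j) k = trans (cong (bit b *_) (bitPower-+ b j k)) (sym (ℚₚ.*-assoc (bit b) (bitPower b j) (bitPower b k)))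

  power : Vec ℕ N → Vec Bool N → ℚ
  power []      []      = 1ℚ
  power (k ∷ α) (b ∷ z) = bitPower b k * power α z

  -- The value of a monomial at the 0/1-point x = z, x̄ = 1 - z.
  ⟦_⟧ : Monomial N → Vec Bool N → ℚ
  ⟦ α , β ⟧ z = power α z * power β (Vec.map not z)

  power-+ : (α β : Vec ℕ N) (z : Vec Bool N) → power (Vec.zipWith ℕ._+_ α β) z ≡ power α z * power β z
  power-+ []      []      []      = refl
  power-+ (j ∷ α) (k ∷ β) (b ∷ z) = trans (cong₂ _*_ (bitPower-+ b j k) (power-+ α β z))
    (solve 4 (λ p q r s → (p :* q) :* (r :* s) := (p :* r) :* (q :* s)) refl (bitPower b j) (bitPower b k) (power α z) (power β z))
    where open +-*-Solver

  ⟦∙⟧ : (m k : Monomial N) (z : Vec Bool N) → ⟦ m ∙ k ⟧ z ≡ ⟦ m ⟧ z * ⟦ k ⟧ z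
  ⟦∙⟧ (α , β) (α′ , β′) z = trans (cong₂ _*_ (power-+ α α′ z) (power-+ β β′ (Vec.map not z)))
    (solve 4 (λ p q r s → (p :* q) :* (r :* s) := (p :* r) :* (q :* s)) refl
      (power α z) (power α′ z) (power β (Vec.map not z)) (power β′ (Vec.map not z)))
    where open +-*-Solver hiding (⟦_⟧)

  power-0 : (z : Vec Bool N) → power (Vec.replicate N 0) z ≡ 1ℚ
  power-0 []      = refl
  power-0 (b ∷ z) = trans (ℚₚ.*-identityˡ _) (power-0 z)

  power-1 : (i : Fin N) (z : Vec Bool N) → power (Vec.replicate N 0 Vec.[ i ]≔ 1) z ≡ bit (lookup z i)
  power-1 zero    (b ∷ z) = trans (cong₂ _*_ (ℚₚ.*-identityʳ (bit b)) (power-0 z)) (ℚₚ.*-identityʳ (bit b))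
  power-1 (suc i) (b ∷ z) = trans (ℚₚ.*-identityˡ _) (power-1 i z)

  ⟦𝟙⟧ : (z : Vec Bool N) → ⟦ 𝟙 ⟧ z ≡ 1ℚ
  ⟦𝟙⟧ z = cong₂ _*_ (power-0 z) (power-0 (Vec.map not z))

  power-cong : (α : Vec ℕ N) {z z′ : Vec Bool N} →
               (∀ e → lookup (Vec.map nonzero? α) e ≡ true → lookup z e ≡ lookup z′ e) → power α z ≡ power α z′
  power-cong []      {[]}    {[]}     eq = refl
  power-cong (zero  ∷ α) {b ∷ z} {b′ ∷ z′} eq = cong (1ℚ *_) (power-cong α (eq ∘ suc))
  power-cong (suc k ∷ α) {b ∷ z} {b′ ∷ z′} eq = cong₂ _*_ (cong (λ c → bitPower c (suc k)) (eq zero refl)) (power-cong α (eq ∘ suc))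

  power-vanishes : (α : Vec ℕ N) (z : Vec Bool N) (e : Fin N) →
                   lookup (Vec.map nonzero? α) e ≡ true → lookup z e ≡ false → power α z ≡ 0ℚ
  power-vanishes (suc k ∷ α) (false ∷ z) zero _ _ =
    trans (cong (_* power α z) (ℚₚ.*-zeroˡ (bitPower false k))) (ℚₚ.*-zeroˡ (power α z))
  power-vanishes (k ∷ α) (b ∷ z) (suc e) p q = trans (cong (bitPower b k *_) (power-vanishes α z e p q)) (ℚₚ.*-zeroʳ (bitPower b k))

  ⟦⟧-vanishes : ∀ b (m : Monomial N) (z : Vec Bool N) {e : Fin N} → e ∈ literals b m → lookup z e ≡ not b → ⟦ m ⟧ z ≡ 0ℚ
  ⟦⟧-vanishes true  (α , β) z {e} e∈ eq =
    trans (cong (_* power β (Vec.map not z)) (power-vanishes α z e (Vecₚ.[]=⇒lookup e∈) eq)) (ℚₚ.*-zeroˡ (power β (Vec.map not z)))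
  ⟦⟧-vanishes false (α , β) z {e} e∈ eq =
    trans (cong (power α z *_) (power-vanishes β (Vec.map not z) e (Vecₚ.[]=⇒lookup e∈)
      (trans (Vecₚ.lookup-map e not z) (cong not eq)))) (ℚₚ.*-zeroʳ (power α z))

  ⟦⟧-cong : (m : Monomial N) {z z′ : Vec Bool N} →
            (∀ b e → e ∈ literals b m → lookup z e ≡ lookup z′ e) → ⟦ m ⟧ z ≡ ⟦ m ⟧ z′
  ⟦⟧-cong (α , β) {z} {z′} agree = cong₂ _*_
    (power-cong α λ e p → agree true e (Vecₚ.lookup⇒[]= e _ p))
    (power-cong β λ e p → trans (Vecₚ.lookup-map e not z)
      (trans (cong not (agree false e (Vecₚ.lookup⇒[]= e _ p))) (sym (Vecₚ.lookup-map e not z′))))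

  -- Real coefficients are replaced by the i-th terms of their Cauchy sequences.
  module Evaluation (i : ℕ) where

    at : Expr N → List (ℚ × Monomial N)
    at = map (λ (a , m) → seq a i , m)

    eval : Expr N → Vec Bool N → ℚ
    eval p z = Σ* (at p) (λ m → ⟦ m ⟧ z)

    eval-⊕ : (p q : Expr N) (z : Vec Bool N) → eval (p ⊕ q) z ≡ eval p z + eval q z
    eval-⊕ p q z = trans (cong (λ L → Σ* L (λ m → ⟦ m ⟧ z)) (Listₚ.map-++ _ p q)) (Σ*-++ (at p) (at q) (λ m → ⟦ m ⟧ z))

    eval-⊖ : (p q : Expr N) (z : Vec Bool N) → eval (p ⊖ q) z ≡ eval p z - eval q z
    eval-⊖ p q z = trans (eval-⊕ p _ z) (cong (eval p z +_) (eval-neg q))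
      where
      eval-neg : ∀ q → eval (map (λ (a , m) → -ᴿ a , m) q) z ≡ - eval q z
      eval-neg [] = refl
      eval-neg ((a , m) ∷ q) = trans (cong (- seq a i * ⟦ m ⟧ z +_) (eval-neg q))
        (solve 3 (λ a m q → :- a :* m :+ :- q := :- (a :* m :+ q)) refl (seq a i) (⟦ m ⟧ z) (eval q z))
        where open +-*-Solver hiding (⟦_⟧)

    eval-⊗ : (p q : Expr N) (z : Vec Bool N) → eval (p ⊗ q) z ≡ eval p z * eval q z
    eval-⊗ []            q z = sym (ℚₚ.*-zeroˡ (eval q z))
    eval-⊗ ((a , m) ∷ p) q z = begin
      eval (scaled q ⊕ (p ⊗ q)) z                      ≡⟨ eval-⊕ (scaled q) (p ⊗ q) z ⟩
      eval (scaled q) z + eval (p ⊗ q) z               ≡⟨ cong₂ _+_ (eval-scaled q) (eval-⊗ p q z) ⟩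
      seq a i * ⟦ m ⟧ z * eval q z + eval p z * eval q z ≡⟨ sym (ℚₚ.*-distribʳ-+ (eval q z) (seq a i * ⟦ m ⟧ z) (eval p z)) ⟩
      (seq a i * ⟦ m ⟧ z + eval p z) * eval q z        ∎
      where
      open ≡-Reasoning
      scaled : Expr _ → Expr _
      scaled = map (λ (b , k) → a *ᴿ b , m ∙ k)
      eval-scaled : ∀ q → eval (scaled q) z ≡ seq a i * ⟦ m ⟧ z * eval q z
      eval-scaled [] = sym (ℚₚ.*-zeroʳ (seq a i * ⟦ m ⟧ z))
      eval-scaled ((b , k) ∷ q) = trans (cong₂ (λ x y → seq a i * seq b i * x + y) (⟦∙⟧ m k z) (eval-scaled q))
        (solve 5 (λ a b m k q → a :* b :* (m :* k) :+ a :* m :* q := a :* m :* (b :* k :+ q)) refl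
          (seq a i) (seq b i) (⟦ m ⟧ z) (⟦ k ⟧ z) (eval q z))
        where open +-*-Solver hiding (⟦_⟧)

    eval-const : (a : ℝ) (z : Vec Bool N) → eval (const a) z ≡ seq a i
    eval-const a z = trans (ℚₚ.+-identityʳ _) (trans (cong (seq a i *_) (⟦𝟙⟧ z)) (ℚₚ.*-identityʳ (seq a i)))

    eval-var : (e : Fin N) (z : Vec Bool N) → eval (var e) z ≡ bit (lookup z e)
    eval-var e z = trans (ℚₚ.+-identityʳ _) (trans (ℚₚ.*-identityˡ _)
      (trans (cong₂ _*_ (power-1 e z) (power-0 (Vec.map not z))) (ℚₚ.*-identityʳ _)))

    eval-twin : (e : Fin N) (z : Vec Bool N) → eval (twin e) z ≡ bit (not (lookup z e))
    eval-twin e z = trans (ℚₚ.+-identityʳ _) (trans (ℚₚ.*-identityˡ _)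
      (trans (cong₂ _*_ (power-0 z) (trans (power-1 e (Vec.map not z)) (cong bit (Vecₚ.lookup-map e not z)))) (ℚₚ.*-identityˡ _)))

    eval-B : (e : Fin N) (b : Axiom) (z : Vec Bool N) → eval (B N e b) z ≡ 0ℚ
    eval-B {N} e x²-x z = trans (eval-⊖ (var e ⊗ var e) (var e) z)
      (trans (cong₂ _-_ (trans (eval-⊗ (var e) (var e) z) (cong₂ _*_ (eval-var e z) (eval-var e z))) (eval-var e z)) (boolean (lookup z e)))
      where
      boolean : ∀ b → bit b * bit b - bit b ≡ 0ℚ
      boolean false = refl
      boolean true  = refl
    eval-B {N} e x̄²-x̄ z = trans (eval-⊖ (twin e ⊗ twin e) (twin e) z)
      (trans (cong₂ _-_ (trans (eval-⊗ (twin e) (twin e) z) (cong₂ _*_ (eval-twin e z) (eval-twin e z))) (eval-twin e z)) (boolean (not (lookup z e))))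
      where
      boolean : ∀ b → bit b * bit b - bit b ≡ 0ℚ
      boolean false = refl
      boolean true  = refl
    eval-B {N} e x+x̄-1 z = trans (eval-⊖ (var e ⊕ twin e) (const 1ᴿ) z)
      (trans (cong₂ _-_ (trans (eval-⊕ (var e) (twin e) z) (cong₂ _+_ (eval-var e z) (eval-twin e z))) (eval-const 1ᴿ z)) (complementary (lookup z e)))
      where
      complementary : ∀ b → bit b + bit (not b) - 1ℚ ≡ 0ℚ
      complementary false = refl
      complementary true  = refl

    parityProduct : List (Fin N) → Vec Bool N → ℚ
    parityProduct es z = foldr (λ e p → sgn (lookup z e) * p) 1ℚ es

    eval-∏ : (es : List (Fin N)) (z : Vec Bool N) →
             eval (∏ (map (λ e → const 1ᴿ ⊖ const (fromℕ 2) ⊗ var e) es)) z ≡ parityProduct es z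
    eval-∏ []       z = eval-const 1ᴿ z
    eval-∏ (e ∷ es) z = trans (eval-⊗ factor (∏ (map (λ e → const 1ᴿ ⊖ const (fromℕ 2) ⊗ var e) es)) z) (cong₂ _*_ (begin
        eval factor z
          ≡⟨ eval-⊖ (const 1ᴿ) (const (fromℕ 2) ⊗ var e) z ⟩
        eval (const 1ᴿ) z - eval (const (fromℕ 2) ⊗ var e) z
          ≡⟨ cong₂ _-_ (eval-const 1ᴿ z) (trans (eval-⊗ (const (fromℕ 2)) (var e) z)
               (cong₂ _*_ (eval-const (fromℕ 2) z) (eval-var e z))) ⟩
        1ℚ - seq (fromℕ 2) i * bit (lookup z e)
          ≡⟨ affine (lookup z e) ⟩
        sgn (lookup z e) ∎) (eval-∏ es z))
      where
      open ≡-Reasoning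
      factor = const 1ᴿ ⊖ const (fromℕ 2) ⊗ var e
      affine : ∀ b → 1ℚ - seq (fromℕ 2) i * bit b ≡ sgn b
      affine false = refl
      affine true  = refl

  -- The sum over F₂: an edge listed twice cancels, which is why `∑⁅⁆-∈` asks for `Unique`.
  ∑⁅_⁆ : List (Fin N) → Subset N
  ∑⁅_⁆ = foldr (λ e S → ⁅ e ⁆ △ S) ⊥

  ∣∑⁅⁆∣≤ : (es : List (Fin N)) → ∣ ∑⁅ es ⁆ ∣ ℕ.≤ length es
  ∣∑⁅⁆∣≤ {N} []  = ∣⊥∣≤ {N}
  ∣∑⁅⁆∣≤ (e ∷ es) = ℕₚ.≤-trans (∣△∣≤ ⁅ e ⁆ ∑⁅ es ⁆)
    (ℕₚ.+-mono-≤ (ℕₚ.≤-reflexive (Subsetₚ.∣⁅x⁆∣≡1 e)) (∣∑⁅⁆∣≤ es))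

  module PseudoExpectation (K : Subset N → Maybe Bool) (w : ℕ) (K-isPC : IsPseudoCharacter (w ℕ.+ w) K) where
    open IsPseudoCharacter K-isPC

    -- The restriction by the values forced on single edges.
    restriction : Vec Bool N → Vec Bool N
    restriction z = tabulate λ e → fromMaybe (lookup z e) (K ⁅ e ⁆)

    -- Composing with `restriction` substitutes the forced edges inside the functional, so no
    -- restricted refutation has to be written down. `χ ∘ K` respects these edges by itself only
    -- within the width; a monomial of high degree with few free edges expands into larger
    -- characters, over which `K-△` has no control.
    Ẽ : (Vec Bool N → ℚ) → ℚ
    Ẽ f = 𝔼 (χ ∘ K) (f ∘ restriction)

    private
      ≤2w : ∀ {k} → k ℕ.≤ w → k ℕ.≤ w ℕ.+ w
      ≤2w p = ℕₚ.≤-trans p (ℕₚ.m≤m+n w w)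

      △≤2w : ∀ {S T : Subset N} → ∣ S ∣ ℕ.≤ w → ∣ T ∣ ℕ.≤ w → ∣ S △ T ∣ ℕ.≤ w ℕ.+ w
      △≤2w {S} {T} p q = ℕₚ.≤-trans (∣△∣≤ S T) (ℕₚ.+-mono-≤ p q)

      lookup-restriction : ∀ z e → lookup (restriction z) e ≡ fromMaybe (lookup z e) (K ⁅ e ⁆)
      lookup-restriction z e = Vecₚ.lookup∘tabulate _ e

    private
      -- Two sets are related when the product of their characters is forced. All pairwise
      -- differences have at most 2w edges, so `K-△` yields transitivity.
      κ : Low N w → Low N w → Maybe Bool
      κ (S , _) (T , _) = K (S △ T)

      κ-trans : ∀ {S T U : Low N w} {a b} → κ S T ≡ just a → κ T U ≡ just b → κ S U ≡ just (a xor b)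
      κ-trans {S , p} {T , q} {U , r} eq eq′ = trans (cong K (sym (△-telescope S T U)))
        (K-△ {S △ T} {T △ U} (△≤2w {S} {T} p q) (△≤2w {T} {U} q r)
          (subst (λ X → ∣ X ∣ ℕ.≤ w ℕ.+ w) (sym (△-telescope S T U)) (△≤2w {S} {U} p r)) eq eq′)

      open SignedEquivalence κ (λ (S , _) → trans (cong K (△-self S)) K-⊥)
        (λ (S , _) (T , _) → cong K (△-comm S T))
        (λ {S} {T} {U} → κ-trans {S} {T} {U})

    -- In terms of character coefficients, the expectation of a square is the quadratic form of the
    -- moment matrix with entries `χ (K (S △ T))`.
    square≥0 : ∀ f → LowDegree w (f ∘ restriction) → 0ℚ ≤ Ẽ (λ z → f z * f z)
    square≥0 f (L , eq) = subst (0ℚ ≤_) (sym (begin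
      Ẽ (λ z → f z * f z)
        ≡⟨ 𝔼-cong (χ ∘ K) (λ z → trans (cong₂ _*_ (eq z) (eq z)) (square z)) ⟩
      𝔼 (χ ∘ K) (λ z → Σ* L (λ S → Σ* L (λ T → lowCharacter S z * lowCharacter T z)))
        ≡⟨ 𝔼-Σ* (χ ∘ K) L (λ S z → Σ* L (λ T → lowCharacter S z * lowCharacter T z)) ⟩
      Σ* L (λ S → 𝔼 (χ ∘ K) (λ z → Σ* L (λ T → lowCharacter S z * lowCharacter T z)))
        ≡⟨ Σ*-cong L (λ S → 𝔼-Σ* (χ ∘ K) L (λ T z → lowCharacter S z * lowCharacter T z)) ⟩
      Σ* L (λ S → Σ* L (λ T → 𝔼 (χ ∘ K) (λ z → lowCharacter S z * lowCharacter T z)))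
        ≡⟨ Σ*-cong L (λ (S , _) → Σ*-cong L (λ (T , _) →
             trans (𝔼-cong (χ ∘ K) (λ z → sym (character-△ S T z))) (𝔼-character (χ ∘ K) (S △ T)))) ⟩
      form L ∎)) (form≥0 L)
      where
      open ≡-Reasoning
      square : ∀ z → Σ* L (λ S → lowCharacter S z) * Σ* L (λ S → lowCharacter S z)
                   ≡ Σ* L (λ S → Σ* L (λ T → lowCharacter S z * lowCharacter T z))
      square z = sym (begin
        Σ* L (λ S → Σ* L (λ T → lowCharacter S z * lowCharacter T z)) ≡⟨ Σ*-cong L (λ S → Σ*-* (lowCharacter S z) L (λ T → lowCharacter T z)) ⟩
        Σ* L (λ S → lowCharacter S z * s)                             ≡⟨ Σ*-cong L (λ S → ℚₚ.*-comm (lowCharacter S z) s) ⟩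
        Σ* L (λ S → s * lowCharacter S z)                             ≡⟨ Σ*-* s L (λ S → lowCharacter S z) ⟩
        s * s ∎)
        where s = Σ* L (λ S → lowCharacter S z)

    monomial-low : ∀ {m} → ¬ Heavy w K m → LowDegree w (⟦ m ⟧ ∘ restriction)
    monomial-low {m} ¬heavy with alive? K m
    -- The restricted monomial is 0, but the bare negation yields no vanishing literal; decidability
    -- of equality in ℚ supplies the missing double-negation elimination.
    ... | no ¬alive = [] , λ z → decidable-stable (⟦ m ⟧ (restriction z) ℚₚ.≟ 0ℚ) λ ≢0 →
          ¬alive λ b e e∈ eq → ≢0 (⟦⟧-vanishes b m (restriction z) e∈
            (trans (lookup-restriction z e) (cong (fromMaybe (lookup z e)) eq)))
    ... | yes alive = lowDegree A (ℕₚ.≤-trans (∣∪∣≤ (freeLiterals K true m) (freeLiterals K false m))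
                        (ℕₚ.≮⇒≥ λ w< → ¬heavy (alive , w<))) (⟦ m ⟧ ∘ restriction)
            λ z z′ agree → ⟦⟧-cong m (λ b e e∈ → determined z z′ agree b e e∈)
      where
      A = freeLiterals K true m ∪ freeLiterals K false m
      ∈A : ∀ b {e} → e ∈ literals b m → K ⁅ e ⁆ ≡ nothing → e ∈ A
      ∈A true  e∈ eq = Subsetₚ.x∈p∪q⁺ (inj₁ (Subsetₚ.x∈p∩q⁺ (∈-free⁺ K eq , e∈)))
      ∈A false e∈ eq = Subsetₚ.x∈p∪q⁺ (inj₂ (Subsetₚ.x∈p∩q⁺ (∈-free⁺ K eq , e∈)))
      determined : ∀ z z′ → (∀ e → e ∈ A → lookup z e ≡ lookup z′ e) →
                   ∀ b e → e ∈ literals b m → lookup (restriction z) e ≡ lookup (restriction z′) e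
      determined z z′ agree b e e∈ = trans (lookup-restriction z e)
        (trans (same (K ⁅ e ⁆) refl) (sym (lookup-restriction z′ e)))
        where
        same : ∀ v → K ⁅ e ⁆ ≡ v → fromMaybe (lookup z e) v ≡ fromMaybe (lookup z′ e) v
        same (just a) _  = refl
        same nothing  eq = agree e (∈A b e∈ eq)

    -- ∏_{e ∈ es} (1 - 2 x_e) restricts to ± the character of the set of its free edges.
    parityProduct-restriction : ∀ i es → length es ℕ.≤ w → ∃[ X ] ∃[ Y ] ∃[ c ]
      (∑⁅ es ⁆ ≡ X △ Y × ∣ X ∣ ℕ.≤ length es × ∣ Y ∣ ℕ.≤ length es × K Y ≡ just c ×
       (∀ z → Evaluation.parityProduct i es (restriction z) ≡ sgn c * character X z))
    parityProduct-restriction i [] _ = ⊥ , ⊥ , false , sym (△-self ⊥) , ∣⊥∣≤ {N} , ∣⊥∣≤ {N} , K-⊥ ,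
      λ z → sym (trans (ℚₚ.*-identityˡ (character ⊥ z)) (character-⊥ z))
    parityProduct-restriction i (e ∷ es) len
      with X , Y , c , eq , X≤ , Y≤ , KY , prod ← parityProduct-restriction i es (ℕₚ.≤-trans (ℕₚ.n≤1+n _) len)
         | K ⁅ e ⁆ in Ke
    ... | nothing = ⁅ e ⁆ △ X , Y , c , trans (cong (⁅ e ⁆ △_) eq) (sym (△-assoc ⁅ e ⁆ X Y)) ,
          insert≤ X≤ , ℕₚ.m≤n⇒m≤1+n Y≤ , KY , λ z → begin
            sgn (lookup (restriction z) e) * Evaluation.parityProduct i es (restriction z)
              ≡⟨ cong₂ (λ b p → sgn b * p) (trans (lookup-restriction z e) (cong (fromMaybe (lookup z e)) Ke)) (prod z) ⟩
            sgn (lookup z e) * (sgn c * character X z)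
              ≡⟨ cong (_* (sgn c * character X z)) (sym (character-⁅⁆ e z)) ⟩
            character ⁅ e ⁆ z * (sgn c * character X z)
              ≡⟨ solve 3 (λ a b c → a :* (b :* c) := b :* (a :* c)) refl (character ⁅ e ⁆ z) (sgn c) (character X z) ⟩
            sgn c * (character ⁅ e ⁆ z * character X z)
              ≡⟨ cong (sgn c *_) (sym (character-△ ⁅ e ⁆ X z)) ⟩
            sgn c * character (⁅ e ⁆ △ X) z ∎
      where
      open ≡-Reasoning
      open +-*-Solver
      insert≤ : ∀ {k} → ∣ X ∣ ℕ.≤ k → ∣ ⁅ e ⁆ △ X ∣ ℕ.≤ suc k
      insert≤ p = ℕₚ.≤-trans (∣△∣≤ ⁅ e ⁆ X) (ℕₚ.+-mono-≤ (ℕₚ.≤-reflexive (Subsetₚ.∣⁅x⁆∣≡1 e)) p)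
    ... | just b = X , ⁅ e ⁆ △ Y , b xor c , trans (cong (⁅ e ⁆ △_) eq) (swap ⁅ e ⁆ X Y) ,
          ℕₚ.m≤n⇒m≤1+n X≤ , insert≤ , KeY , λ z → begin
            sgn (lookup (restriction z) e) * Evaluation.parityProduct i es (restriction z)
              ≡⟨ cong₂ (λ b p → sgn b * p) (trans (lookup-restriction z e) (cong (fromMaybe (lookup z e)) Ke)) (prod z) ⟩
            sgn b * (sgn c * character X z)
              ≡⟨ sym (ℚₚ.*-assoc (sgn b) (sgn c) (character X z)) ⟩
            sgn b * sgn c * character X z
              ≡⟨ cong (_* character X z) (sym (sgn-xor b c)) ⟩
            sgn (b xor c) * character X z ∎
      where
      open ≡-Reasoning
      swap : ∀ (S T U : Subset N) → S △ T △ U ≡ T △ S △ U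
      swap S T U = trans (sym (△-assoc S T U)) (trans (cong (_△ U) (△-comm S T)) (△-assoc T S U))
      ⁅e⁆≤ : ∣ ⁅ e ⁆ ∣ ℕ.≤ 1
      ⁅e⁆≤ = ℕₚ.≤-reflexive (Subsetₚ.∣⁅x⁆∣≡1 e)
      insert≤ : ∣ ⁅ e ⁆ △ Y ∣ ℕ.≤ suc (length es)
      insert≤ = ℕₚ.≤-trans (∣△∣≤ ⁅ e ⁆ Y) (ℕₚ.+-mono-≤ ⁅e⁆≤ Y≤)
      KeY : K (⁅ e ⁆ △ Y) ≡ just (b xor c)
      KeY = K-△ (≤2w (ℕₚ.≤-trans ⁅e⁆≤ (ℕₚ.≤-trans (s≤s z≤n) len)))
                (≤2w (ℕₚ.≤-trans Y≤ (ℕₚ.≤-trans (ℕₚ.n≤1+n _) len)))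
                (≤2w (ℕₚ.≤-trans insert≤ len)) Ke KY

    private
      -- As `X` is forced, `S` and `S △ X` are either both unforced, so that both terms are 0, or
      -- both forced with values differing by `b`; then the sign condition makes the terms cancel.
      character-constraint : ∀ {X b c} → sgn c * sgn b ≡ - 1ℚ → K X ≡ just b → ∣ X ∣ ℕ.≤ w →
        (S : Low N w) → 𝔼 (χ ∘ K) (λ z → lowCharacter S z * (sgn c * character X z + 1ℚ)) ≡ 0ℚ
      character-constraint {X} {b} {c} cb KX X≤ (S , S≤) = begin
        𝔼 (χ ∘ K) (λ z → character S z * (sgn c * character X z + 1ℚ))
          ≡⟨ 𝔼-cong (χ ∘ K) (λ z → trans
               (solve 3 (λ s c x → s :* (c :* x :+ con 1ℚ) := c :* (s :* x) :+ con 1ℚ :* s) refl (character S z) (sgn c) (character X z))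
               (cong (λ p → sgn c * p + 1ℚ * character S z) (sym (character-△ S X z)))) ⟩
        𝔼 (χ ∘ K) (λ z → sgn c * character (S △ X) z + 1ℚ * character S z)
          ≡⟨ 𝔼-linear (χ ∘ K) (sgn c) 1ℚ (character (S △ X)) (character S) ⟩
        sgn c * 𝔼 (χ ∘ K) (character (S △ X)) + 1ℚ * 𝔼 (χ ∘ K) (character S)
          ≡⟨ cong₂ (λ p q → sgn c * p + 1ℚ * q) (𝔼-character (χ ∘ K) (S △ X)) (𝔼-character (χ ∘ K) S) ⟩
        sgn c * χ (K (S △ X)) + 1ℚ * χ (K S)
          ≡⟨ cancel (K S) refl (K (S △ X)) refl ⟩
        0ℚ ∎
        where
        open ≡-Reasoning
        open +-*-Solver
        X≤2w = ≤2w X≤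
        S≤2w = ≤2w S≤
        SX≤2w : ∣ S △ X ∣ ℕ.≤ w ℕ.+ w
        SX≤2w = △≤2w {S} {X} S≤ X≤
        cancel : ∀ u → K S ≡ u → ∀ v → K (S △ X) ≡ v → sgn c * χ v + 1ℚ * χ u ≡ 0ℚ
        cancel nothing  _  nothing  _  = trans (cong (_+ 1ℚ * 0ℚ) (ℚₚ.*-zeroʳ (sgn c))) refl
        cancel nothing  KS (just _) KSX with trans (sym KS) (trans (cong K (sym (△-cancelʳ S X)))
          (K-△ SX≤2w X≤2w (subst (λ Y → ∣ Y ∣ ℕ.≤ w ℕ.+ w) (sym (△-cancelʳ S X)) S≤2w) KSX KX))
        ... | ()
        cancel (just a) KS nothing  KSX with trans (sym KSX) (K-△ S≤2w X≤2w SX≤2w KS KX)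
        ... | ()
        cancel (just a) KS (just v) KSX with trans (sym KSX) (K-△ S≤2w X≤2w SX≤2w KS KX)
        ... | refl = begin
          sgn c * sgn (a xor b) + 1ℚ * sgn a      ≡⟨ cong (λ p → sgn c * p + 1ℚ * sgn a) (sgn-xor a b) ⟩
          sgn c * (sgn a * sgn b) + 1ℚ * sgn a    ≡⟨ solve 3 (λ a b c → c :* (a :* b) :+ con 1ℚ :* a := a :* (c :* b :+ con 1ℚ)) refl (sgn a) (sgn b) (sgn c) ⟩
          sgn a * (sgn c * sgn b + 1ℚ)            ≡⟨ cong (λ p → sgn a * (p + 1ℚ)) cb ⟩
          sgn a * 0ℚ                              ≡⟨ ℚₚ.*-zeroʳ (sgn a) ⟩
          0ℚ                                      ∎

    -- The restricted product is ± the character of its free part `X`, the sign `c` coming from the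
    -- forced part `Y`. Since X △ Y is forced to `true`, `X` is forced to `true xor c`, and
    -- `character-constraint` applies to every character in the expansion of the multiplier.
    constraint≡0 : ∀ i (es : List (Fin N)) → length es ℕ.≤ w → K ∑⁅ es ⁆ ≡ just true →
                   ∀ f → LowDegree w (f ∘ restriction) →
                   Ẽ (λ z → f z * (Evaluation.parityProduct i es z + 1ℚ)) ≡ 0ℚ
    constraint≡0 i es len Kes f (L , eq)
      with X , Y , c , es≡ , X≤ , Y≤ , KY , prod ← parityProduct-restriction i es len = begin
      Ẽ (λ z → f z * (Evaluation.parityProduct i es z + 1ℚ))
        ≡⟨ 𝔼-cong (χ ∘ K) (λ z → trans (cong₂ (λ p q → p * (q + 1ℚ)) (eq z) (prod z))
             (trans (ℚₚ.*-comm _ (rest z)) (sym (Σ*-* (rest z) L (λ S → lowCharacter S z))))) ⟩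
      𝔼 (χ ∘ K) (λ z → Σ* L (λ S → rest z * lowCharacter S z))
        ≡⟨ 𝔼-Σ* (χ ∘ K) L (λ S z → rest z * lowCharacter S z) ⟩
      Σ* L (λ S → 𝔼 (χ ∘ K) (λ z → rest z * lowCharacter S z))
        ≡⟨ Σ*-0 L (λ S → trans (𝔼-cong (χ ∘ K) (λ z → ℚₚ.*-comm (rest z) (lowCharacter S z)))
             (character-constraint {X} {true xor c} {c} (signs c) KX (ℕₚ.≤-trans X≤ len) S)) ⟩
      0ℚ ∎
      where
      open ≡-Reasoning
      rest : Vec Bool N → ℚ
      rest z = sgn c * character X z + 1ℚ
      signs : ∀ c → sgn c * sgn (true xor c) ≡ - 1ℚ
      signs false = refl
      signs true  = refl
      X≡ : ∑⁅ es ⁆ △ Y ≡ X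
      X≡ = trans (cong (_△ Y) es≡) (△-cancelʳ X Y)
      KX : K X ≡ just (true xor c)
      KX = trans (cong K (sym X≡)) (K-△ (≤2w (ℕₚ.≤-trans (∣∑⁅⁆∣≤ es) len)) (≤2w (ℕₚ.≤-trans Y≤ len))
        (subst (λ Z → ∣ Z ∣ ℕ.≤ w ℕ.+ w) (sym X≡) (≤2w (ℕₚ.≤-trans X≤ len))) Kes KY)

  -- Comparing real polynomials at a late index

  open Evaluation

  private
    coefficients : ℕ → Expr N → List (Monomial N) → List (ℚ × Monomial N)
    coefficients i p = map (λ m → seq (coeff p m) i , m)

    coefficients-[] : ∀ i (M : List (Monomial N)) μ → Σ* (coefficients i [] M) μ ≡ 0ℚ
    coefficients-[] i []      μ = refl
    coefficients-[] i (m ∷ M) μ = trans (cong (0ℚ * μ m +_) (coefficients-[] i M μ)) (trans (ℚₚ.+-identityʳ _) (ℚₚ.*-zeroˡ (μ m)))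

    coefficients-∉ : ∀ i a k (p : Expr N) {M} μ → All (k ≢_) M →
                     Σ* (coefficients i ((a , k) ∷ p) M) μ ≡ Σ* (coefficients i p M) μ
    coefficients-∉ i a k p μ [] = refl
    coefficients-∉ i a k p {m ∷ M} μ (k≢m ∷ k∉) with k ≟ᴹ m
    ... | yes k≡m = contradiction k≡m k≢m
    ... | no  _   = cong (seq (coeff p m) i * μ m +_) (coefficients-∉ i a k p μ k∉)

    coefficients-∷ : ∀ i a k (p : Expr N) {M} μ → Unique M → k List∈.∈ M →
                     Σ* (coefficients i ((a , k) ∷ p) M) μ ≡ seq a i * μ k + Σ* (coefficients i p M) μ
    coefficients-∷ i a k p {m ∷ M} μ (m∉ ∷ unique) k∈ with k ≟ᴹ m
    ... | yes refl = trans (cong ((seq a i + seq (coeff p m) i) * μ m +_) (coefficients-∉ i a k p μ m∉))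
      (solve 4 (λ a c x y → (a :+ c) :* x :+ y := a :* x :+ (c :* x :+ y)) refl (seq a i) (seq (coeff p m) i) (μ m) _)
      where open +-*-Solver hiding (⟦_⟧)
    ... | no k≢m with k∈
    ...   | here k≡m  = contradiction k≡m k≢m
    ...   | there k∈M = trans (cong (seq (coeff p m) i * μ m +_) (coefficients-∷ i a k p μ unique k∈M))
      (solve 3 (λ x y z → x :+ (y :+ z) := y :+ (x :+ z)) refl (seq (coeff p m) i * μ m) (seq a i * μ k) _)
      where open +-*-Solver hiding (⟦_⟧)

    -- `coeff` already adds up all terms with the same monomial, so each monomial may be visited
    -- only once, whence `Unique M`.
    collect : ∀ i (p : Expr N) {M} μ → Unique M → (∀ {m} → m List∈.∈ map proj₂ p → m List∈.∈ M) →
              Σ* (at i p) μ ≡ Σ* (coefficients i p M) μ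
    collect i []            {M} μ _ _ = sym (coefficients-[] i M μ)
    collect i ((a , k) ∷ p) μ unique ⊆M = trans (cong (seq a i * μ k +_) (collect i p μ unique (⊆M ∘ there)))
      (sym (coefficients-∷ i a k p μ unique (⊆M (here refl))))

    Close : ℚ → Expr N → Expr N → ℕ → Monomial N → Set
    Close η p q i m = ℚ.∣ seq (coeff p m) i - seq (coeff q m) i ∣ < η

    eventually-close : (p q : Expr N) → p ≈ q → ∀ {η} → 0ℚ < η → ∀ M →
                       ∃[ n ] (∀ i → n ℕ.≤ i → All (Close η p q i) M)
    eventually-close p q p≈q η>0 []      = 0 , λ _ _ → []
    eventually-close p q p≈q η>0 (m ∷ M) with p≈q m _ η>0 | eventually-close p q p≈q η>0 M
    ... | n₁ , close₁ | n₂ , close₂ = n₁ ℕ.⊔ n₂ , λ i n≤i →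
          close₁ i (ℕₚ.m⊔n≤o⇒m≤o n₁ n₂ n≤i) ∷ close₂ i (ℕₚ.m⊔n≤o⇒n≤o n₁ n₂ n≤i)

    ∑∣_∣ : (Monomial N → ℚ) → List (Monomial N) → ℚ
    ∑∣ μ ∣ = foldr (λ m s → ℚ.∣ μ m ∣ + s) 0ℚ

    ∑∣∣≥0 : (μ : Monomial N → ℚ) → ∀ M → 0ℚ ≤ ∑∣ μ ∣ M
    ∑∣∣≥0 μ []      = ℚₚ.≤-refl
    ∑∣∣≥0 μ (m ∷ M) = 0≤+ (ℚₚ.0≤∣p∣ (μ m)) (∑∣∣≥0 μ M)

    close-sums : ∀ {η i} (p q : Expr N) μ {M} → All (Close η p q i) M →
                 ℚ.∣ Σ* (coefficients i p M) μ - Σ* (coefficients i q M) μ ∣ ≤ η * ∑∣ μ ∣ M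
    close-sums {η = η} p q μ [] = ℚₚ.≤-reflexive (sym (ℚₚ.*-zeroʳ η))
    close-sums {η = η} {i} p q μ {m ∷ M} (close ∷ rest) = begin
      ℚ.∣ (a * μ m + s) - (b * μ m + t) ∣
        ≡⟨ cong ℚ.∣_∣ (solve 5 (λ a b u s t → (a :* u :+ s) :- (b :* u :+ t) := (a :- b) :* u :+ (s :- t)) refl a b (μ m) s t) ⟩
      ℚ.∣ (a - b) * μ m + (s - t) ∣
        ≤⟨ ℚₚ.∣p+q∣≤∣p∣+∣q∣ ((a - b) * μ m) (s - t) ⟩
      ℚ.∣ (a - b) * μ m ∣ + ℚ.∣ s - t ∣
        ≡⟨ cong (_+ ℚ.∣ s - t ∣) (ℚₚ.∣p*q∣≡∣p∣*∣q∣ (a - b) (μ m)) ⟩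
      ℚ.∣ a - b ∣ * ℚ.∣ μ m ∣ + ℚ.∣ s - t ∣
        ≤⟨ ℚₚ.+-mono-≤ (ℚₚ.*-monoʳ-≤-nonNeg ℚ.∣ μ m ∣ {{ℚ.nonNegative (ℚₚ.0≤∣p∣ (μ m))}} (ℚₚ.<⇒≤ close)) (close-sums p q μ rest) ⟩
      η * ℚ.∣ μ m ∣ + η * ∑∣ μ ∣ M
        ≡⟨ sym (ℚₚ.*-distribˡ-+ η ℚ.∣ μ m ∣ (∑∣ μ ∣ M)) ⟩
      η * (ℚ.∣ μ m ∣ + ∑∣ μ ∣ M) ∎
      where
      open ℚₚ.≤-Reasoning
      open +-*-Solver hiding (⟦_⟧)
      a = seq (coeff p m) i
      b = seq (coeff q m) i
      s = Σ* (coefficients i p M) μ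
      t = Σ* (coefficients i q M) μ

  -- The coefficients of p and q agree only in the limit, but a common index i
  -- at which the finitely many differences are small is enough.
  ≈⇒functionals-close : (p q : Expr N) → p ≈ q → (μ : Monomial N → ℚ) →
                        ∃[ i ] ℚ.∣ Σ* (at i p) μ - Σ* (at i q) μ ∣ < 1ℚ
  ≈⇒functionals-close p q p≈q μ = n , (begin-strict
      ℚ.∣ Σ* (at n p) μ - Σ* (at n q) μ ∣
        ≡⟨ cong ℚ.∣_∣ (cong₂ _-_ (collect n p μ unique (λ m∈ → M⊇ (List∈ₚ.∈-++⁺ˡ m∈)))
                                 (collect n q μ unique (λ m∈ → M⊇ (List∈ₚ.∈-++⁺ʳ (map proj₂ p) m∈)))) ⟩
      ℚ.∣ Σ* (coefficients n p M) μ - Σ* (coefficients n q M) μ ∣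
        ≤⟨ close-sums p q μ (proj₂ eventually n ℕₚ.≤-refl) ⟩
      η * S
        <⟨ ℚₚ.*-monoʳ-<-pos η {{η⁺}} S<S+1 ⟩
      η * (1ℚ + S)
        ≡⟨ ℚₚ.*-inverseˡ (1ℚ + S) ⟩
      1ℚ ∎)
    where
    open ℚₚ.≤-Reasoning
    M = deduplicate _≟ᴹ_ (map proj₂ p ++ map proj₂ q)
    unique : Unique M
    unique = deduplicate-! _≟ᴹ_ (map proj₂ p ++ map proj₂ q)
    M⊇ : ∀ {m} → m List∈.∈ map proj₂ p ++ map proj₂ q → m List∈.∈ M
    M⊇ = List∈ₚ.∈-deduplicate⁺ _≟ᴹ_
    S = ∑∣ μ ∣ M
    S<S+1 : S < 1ℚ + S
    S<S+1 = ℚₚ.≤-<-trans (ℚₚ.≤-reflexive (sym (ℚₚ.+-identityˡ S))) (ℚₚ.+-monoˡ-< S (ℚₚ.positive⁻¹ 1ℚ))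
    instance
      1+S⁺ : ℚ.Positive (1ℚ + S)
      1+S⁺ = ℚ.positive (ℚₚ.≤-<-trans (∑∣∣≥0 μ M) S<S+1)
      1+S≢0 : ℚ.NonZero (1ℚ + S)
      1+S≢0 = ℚₚ.pos⇒nonZero (1ℚ + S)
    -- `S` is the total absolute weight of `μ` on the monomials involved; coefficient errors below
    -- `η` then change the sum by at most S / (1 + S) < 1. The added 1 keeps the denominator
    -- positive.
    η = ℚ.1/ (1ℚ + S)
    η⁺ : ℚ.Positive η
    η⁺ = ℚₚ.1/pos⇒pos (1ℚ + S)
    η>0 : 0ℚ < η
    η>0 = ℚₚ.positive⁻¹ η {{η⁺}}
    eventually = eventually-close p q p≈q η>0 M
    n = proj₁ eventually

  private
    -- The gap between -1 and the nonnegative numbers explains the tolerance 1 in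
    -- `≈⇒functionals-close`.
    apart : ∀ {l r} → l ≡ - 1ℚ → 0ℚ ≤ r → ¬ (ℚ.∣ l - r ∣ < 1ℚ)
    apart {r = r} refl 0≤r close = ℚₚ.<-irrefl refl (ℚₚ.≤-<-trans (begin
      1ℚ                           ≤⟨ ℚₚ.+-monoʳ-≤ 1ℚ 0≤r ⟩
      1ℚ + r                       ≡⟨ sym (ℚₚ.0≤p⇒∣p∣≡p (ℚₚ.≤-trans (ℚₚ.nonNegative⁻¹ 1ℚ) (ℚₚ.+-monoʳ-≤ 1ℚ 0≤r))) ⟩
      ℚ.∣ 1ℚ + r ∣                 ≡⟨ sym (ℚₚ.∣-p∣≡∣p∣ (1ℚ + r)) ⟩
      ℚ.∣ - (1ℚ + r) ∣             ≡⟨ cong ℚ.∣_∣ (ℚₚ.neg-distrib-+ 1ℚ r) ⟩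
      ℚ.∣ - 1ℚ - r ∣               ∎) close)
      where open ℚₚ.≤-Reasoning

  -- Monomial size and soundness of the pseudo-expectation

  polynomials : {Q : System N} → Refutation Q → List (Polynomial N)
  polynomials Π = r₀ ++ concatMap r (allFin _) ++ List.tabulate t
    where open Refutation Π

  -- Repetitions are kept, so the length of this list is exactly the monomial size.
  monomials : {Q : System N} → Refutation Q → List (Monomial N)
  monomials Π = concatMap (map proj₂ ∘ terms) (polynomials Π)

  private
    sum-size-++ : (ps : List (Polynomial N)) {qs : List (Polynomial N)} →
                  sum (map size (ps ++ qs)) ≡ sum (map size ps) ℕ.+ sum (map size qs)
    sum-size-++ []       = refl
    sum-size-++ (p ∷ ps) = trans (cong (size p ℕ.+_) (sum-size-++ ps)) (sym (ℕₚ.+-assoc (size p) _ _))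

    sum-size-concat : (f : X → List (Polynomial N)) (xs : List X) →
                      sum (map size (concatMap f xs)) ≡ sum (map (λ x → sum (map size (f x))) xs)
    sum-size-concat f []       = refl
    sum-size-concat f (x ∷ xs) = trans (sum-size-++ (f x)) (cong (sum (map size (f x)) ℕ.+_) (sum-size-concat f xs))

    length-terms : (ps : List (Polynomial N)) → length (concatMap (map proj₂ ∘ terms) ps) ≡ sum (map size ps)
    length-terms []       = refl
    length-terms (p ∷ ps) = trans (Listₚ.length-++ (map proj₂ (terms p)))
      (cong₂ ℕ._+_ (Listₚ.length-map proj₂ (terms p)) (length-terms ps))

  length-monomials : {Q : System N} (Π : Refutation Q) → length (monomials Π) ≡ monomialSize Π
  length-monomials Π = begin
    length (monomials Π)
      ≡⟨ length-terms (polynomials Π) ⟩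
    sum (map size (r₀ ++ concatMap r (allFin _) ++ List.tabulate t))
      ≡⟨ trans (sum-size-++ r₀) (cong (sum (map size r₀) ℕ.+_) (sum-size-++ (concatMap r (allFin _)))) ⟩
    sum (map size r₀) ℕ.+ (sum (map size (concatMap r (allFin _))) ℕ.+ sum (map size (List.tabulate t)))
      ≡⟨ sym (ℕₚ.+-assoc (sum (map size r₀)) _ _) ⟩
    sum (map size r₀) ℕ.+ sum (map size (concatMap r (allFin _))) ℕ.+ sum (map size (List.tabulate t))
      ≡⟨ cong₂ (λ x y → sum (map size r₀) ℕ.+ x ℕ.+ y)
           (trans (sum-size-concat r (allFin _)) (cong sum (Listₚ.map-tabulate id (λ j → sum (map size (r j))))))
           (cong sum (Listₚ.map-tabulate t size)) ⟩
    monomialSize Π ∎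
    where
    open ≡-Reasoning
    open Refutation Π hiding (monomialSize)

  module Soundness (K : Subset N → Maybe Bool) (w : ℕ) (K-isPC : IsPseudoCharacter (w ℕ.+ w) K) where
    open PseudoExpectation K w K-isPC

    private
      k : Subset N → ℚ
      k = χ ∘ K

      Ẽ-cong : ∀ {f g} → (∀ z → f z ≡ g z) → Ẽ f ≡ Ẽ g
      Ẽ-cong eq = 𝔼-cong k (eq ∘ restriction)

      Light : Polynomial N → Set
      Light p = All (λ m → ¬ Heavy w K m) (map proj₂ (terms p))

    module _ (i : ℕ) where

      Ẽ-eval : ∀ p → Σ* (at i p) (λ m → Ẽ ⟦ m ⟧) ≡ Ẽ (eval i p)
      Ẽ-eval p = sym (𝔼-Σ* k (at i p) (λ m z → ⟦ m ⟧ (restriction z)))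

      Ẽ-⊕ : ∀ p q → Ẽ (eval i (p ⊕ q)) ≡ Ẽ (eval i p) + Ẽ (eval i q)
      Ẽ-⊕ p q = trans (Ẽ-cong (eval-⊕ i p q)) (𝔼-+ k (eval i p ∘ restriction) (eval i q ∘ restriction))

      Ẽ-const : ∀ a → Ẽ (eval i (const a)) ≡ seq a i
      Ẽ-const a = begin
        Ẽ (eval i (const a))                 ≡⟨ 𝔼-cong k (λ z → trans (eval-const i a (restriction z))
                                                  (sym (trans (cong (seq a i *_) (character-⊥ z)) (ℚₚ.*-identityʳ (seq a i))))) ⟩
        𝔼 k (λ z → seq a i * character ⊥ z)  ≡⟨ 𝔼-* k (seq a i) (character ⊥) ⟩
        seq a i * 𝔼 k (character ⊥)          ≡⟨ cong (seq a i *_) (trans (𝔼-character k ⊥) (cong χ (IsPseudoCharacter.K-⊥ K-isPC))) ⟩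
        seq a i * 1ℚ                         ≡⟨ ℚₚ.*-identityʳ (seq a i) ⟩
        seq a i                              ∎
        where open ≡-Reasoning

      eval-low : ∀ p → All (λ m → ¬ Heavy w K m) (map proj₂ p) → LowDegree w (eval i p ∘ restriction)
      eval-low [] [] = [] , λ _ → refl
      eval-low ((a , m) ∷ p) (¬heavy ∷ rest) with monomial-low ¬heavy | eval-low p rest
      ... | L , eq | M , eq′ = map (λ (c , S) → seq a i * c , S) L ++ M , λ z → begin
        seq a i * ⟦ m ⟧ (restriction z) + eval i p (restriction z)
          ≡⟨ cong₂ (λ x y → seq a i * x + y) (eq z) (eq′ z) ⟩
        seq a i * Σ* L (λ S → lowCharacter S z) + Σ* M (λ S → lowCharacter S z)
          ≡⟨ cong (_+ Σ* M (λ S → lowCharacter S z)) (sym (Σ*-scale (seq a i) L (λ S → lowCharacter S z))) ⟩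
        Σ* (map (λ (c , S) → seq a i * c , S) L) (λ S → lowCharacter S z) + Σ* M (λ S → lowCharacter S z)
          ≡⟨ sym (Σ*-++ (map (λ (c , S) → seq a i * c , S) L) M (λ S → lowCharacter S z)) ⟩
        Σ* (map (λ (c , S) → seq a i * c , S) L ++ M) (λ S → lowCharacter S z) ∎
        where open ≡-Reasoning

      Ẽ-squares≥0 : ∀ rs → All Light rs → 0ℚ ≤ Ẽ (eval i (sumOfSquares rs))
      Ẽ-squares≥0 [] [] = ℚₚ.≤-reflexive (sym (𝔼-0 k))
      Ẽ-squares≥0 (r ∷ rs) (light ∷ lights) = subst (0ℚ ≤_) (sym (Ẽ-⊕ (terms r ⊗ terms r) (sumOfSquares rs)))
        (0≤+ (subst (0ℚ ≤_) (sym (Ẽ-cong (eval-⊗ i (terms r) (terms r)))) (square≥0 (eval i (terms r)) (eval-low (terms r) light)))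
             (Ẽ-squares≥0 rs lights))

      Ẽ-∑≥0 : ∀ {m} (f : Fin m → Expr N) → (∀ j → 0ℚ ≤ Ẽ (eval i (f j))) → 0ℚ ≤ Ẽ (eval i (∑ (List.tabulate f)))
      Ẽ-∑≥0 {zero}  f f≥0 = ℚₚ.≤-reflexive (sym (𝔼-0 k))
      Ẽ-∑≥0 {suc m} f f≥0 = subst (0ℚ ≤_) (sym (Ẽ-⊕ (f zero) (∑ (List.tabulate (f ∘ suc)))))
        (0≤+ (f≥0 zero) (Ẽ-∑≥0 (f ∘ suc) (f≥0 ∘ suc)))

      Ẽ-axioms≡0 : ∀ e (u : Axiom → Polynomial N) bs → Ẽ (eval i (∑ (map (λ b → terms (u b) ⊗ B N e b) bs))) ≡ 0ℚ
      Ẽ-axioms≡0 e u bs = trans (Ẽ-cong (vanishes bs)) (𝔼-0 k)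
        where
        vanishes : ∀ bs z → eval i (∑ (map (λ b → terms (u b) ⊗ B N e b) bs)) z ≡ 0ℚ
        vanishes []       z = refl
        vanishes (b ∷ bs) z = trans (eval-⊕ i (terms (u b) ⊗ B N e b) (∑ (map (λ b → terms (u b) ⊗ B N e b) bs)) z)
          (cong₂ _+_ (trans (eval-⊗ i (terms (u b)) (B N e b) z)
            (trans (cong (eval i (terms (u b)) z *_) (eval-B i e b z)) (ℚₚ.*-zeroʳ (eval i (terms (u b)) z)))) (vanishes bs z))

    -- Replacing coefficients by their terms at one index preserves the shape of the right-hand
    -- side: squares stay squares and multiples stay multiples, so `Ẽ` of it is nonnegative exactly.
    -- The approximation affects only the identity itself. Positivity is asked at every index
    -- because the index is dictated by the refutation and by `Ẽ`.
    no-light-refutation : {Q : System N} → let open System Q in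
      (∀ i rs j → All Light rs → 0ℚ ≤ Ẽ (eval i (sumOfSquares rs ⊗ q j))) →
      (∀ i s j → LowDegree w (eval i s ∘ restriction) → Ẽ (λ z → eval i s z * eval i (p j) z) ≡ 0ℚ) →
      (Π : Refutation Q) → ¬ All (λ m → ¬ Heavy w K m) (monomials Π)
    no-light-refutation {Q} q≥0 p≡0 Π light = apart (trans (Ẽ-eval i (const (-ᴿ 1ᴿ))) (Ẽ-const i (-ᴿ 1ᴿ)))
        (subst (0ℚ ≤_) (sym (Ẽ-eval i rhs)) rhs≥0) (proj₂ separated)
      where
      open System Q
      open Refutation Π hiding (monomialSize)

      lights : All Light (polynomials Π)
      lights = Allₚ.map⁻ (Allₚ.concat⁻ light)

      r₀-light : All Light r₀
      r₀-light = Allₚ.++⁻ˡ r₀ lights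

      r-light : ∀ j → All Light (r j)
      r-light j = All.lookup (Allₚ.map⁻ (Allₚ.concat⁻ {xss = map r (allFin _)} (Allₚ.++⁻ˡ (concatMap r (allFin _)) (Allₚ.++⁻ʳ r₀ lights)))) (List∈ₚ.∈-allFin j)

      t-light : ∀ j → Light (t j)
      t-light = Allₚ.tabulate⁻ (Allₚ.++⁻ʳ (concatMap r (allFin _)) (Allₚ.++⁻ʳ r₀ lights))

      S₁ S₂ S₃ : Expr N
      S₁ = ∑ (List.tabulate λ j → sumOfSquares (r j) ⊗ q j)
      S₂ = ∑ (List.tabulate λ j → terms (t j) ⊗ p j)
      S₃ = ∑ (List.tabulate λ e → ∑ (map (λ b → terms (u e b) ⊗ B N e b) axioms))

      rhs : Expr N
      rhs = sumOfSquares r₀ ⊕ S₁ ⊕ S₂ ⊕ S₃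

      separated : ∃[ i ] ℚ.∣ Σ* (at i (const (-ᴿ 1ᴿ))) (λ m → Ẽ ⟦ m ⟧) - Σ* (at i rhs) (λ m → Ẽ ⟦ m ⟧) ∣ < 1ℚ
      separated = ≈⇒functionals-close (const (-ᴿ 1ᴿ)) rhs identity (λ m → Ẽ ⟦ m ⟧)

      i : ℕ
      i = proj₁ separated

      rhs≥0 : 0ℚ ≤ Ẽ (eval i rhs)
      rhs≥0 = subst (0ℚ ≤_) (sym (begin
        Ẽ (eval i (sumOfSquares r₀ ⊕ S₁ ⊕ S₂ ⊕ S₃))
          ≡⟨ Ẽ-⊕ i (sumOfSquares r₀ ⊕ S₁ ⊕ S₂) S₃ ⟩
        Ẽ (eval i (sumOfSquares r₀ ⊕ S₁ ⊕ S₂)) + Ẽ (eval i S₃)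
          ≡⟨ cong (_+ Ẽ (eval i S₃)) (Ẽ-⊕ i (sumOfSquares r₀ ⊕ S₁) S₂) ⟩
        Ẽ (eval i (sumOfSquares r₀ ⊕ S₁)) + Ẽ (eval i S₂) + Ẽ (eval i S₃)
          ≡⟨ cong (λ x → x + Ẽ (eval i S₂) + Ẽ (eval i S₃)) (Ẽ-⊕ i (sumOfSquares r₀) S₁) ⟩
        Ẽ (eval i (sumOfSquares r₀)) + Ẽ (eval i S₁) + Ẽ (eval i S₂) + Ẽ (eval i S₃) ∎))
        (0≤+ (0≤+ (0≤+ (Ẽ-squares≥0 i r₀ r₀-light)
                       (Ẽ-∑≥0 i _ λ j → q≥0 i (r j) j (r-light j)))
                  (Ẽ-∑≥0 i _ λ j → ℚₚ.≤-reflexive (sym (trans (Ẽ-cong (eval-⊗ i (terms (t j)) (p j)))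
                     (p≡0 i (terms (t j)) j (eval-low i (terms (t j)) (t-light j)))))))
             (Ẽ-∑≥0 i _ λ e → ℚₚ.≤-reflexive (sym (Ẽ-axioms≡0 i e (u e) axioms))))
        where open ≡-Reasoning

  module Tseitin {n : ℕ} (H : Graph n) (K : Subset (Graph.∣E∣ H) → Maybe Bool) (w : ℕ)
                 (K-isPC : IsPseudoCharacter (w ℕ.+ w) K)
                 (degree≤w : ∀ u → Graph.degree H u ℕ.≤ w)
                 (K-incident : ∀ u → K ∑⁅ Graph.incident H u ⁆ ≡ just true) where
    open Graph H
    open PseudoExpectation K w K-isPC

    private
      p : Fin n → Expr ∣E∣
      p = System.p (TS H)

      eval-p : ∀ i u z → eval i (p u) z ≡ parityProduct i (incident u) z + 1ℚ
      eval-p i u z = trans (eval-⊖ i (∏ (map (λ e → const 1ᴿ ⊖ const (fromℕ 2) ⊗ var e) (incident u))) (const (-ᴿ 1ᴿ)) z)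
        (cong₂ _-_ (eval-∏ i (incident u) z) (eval-const i (-ᴿ 1ᴿ) z))

      p≡0 : ∀ i s u → LowDegree w (eval i s ∘ restriction) → Ẽ (λ z → eval i s z * eval i (p u) z) ≡ 0ℚ
      p≡0 i s u low = trans (𝔼-cong (χ ∘ K) (λ z → cong (eval i s (restriction z) *_) (eval-p i u (restriction z))))
        (constraint≡0 i (incident u) (degree≤w u) (K-incident u) (eval i s) low)

    not-all-light : (Π : Refutation (TS H)) → ¬ All (λ m → ¬ Heavy w K m) (monomials Π)
    not-all-light = Soundness.no-light-refutation K w K-isPC {TS H} (λ _ _ ()) p≡0

-- Expanders

open import Data.Nat using (_+_; _*_; _^_; _≤_; _<_)

lookup-ext : {A : Set} {xs ys : Vec A N} → (∀ e → lookup xs e ≡ lookup ys e) → xs ≡ ys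
lookup-ext {xs = xs} {ys} eq = trans (sym (Vecₚ.tabulate∘lookup xs)) (trans (Vecₚ.tabulate-cong eq) (Vecₚ.tabulate∘lookup ys))

parity : Subset N → Bool
parity []      = false
parity (s ∷ S) = s xor parity S

parity-△ : (S T : Subset N) → parity (S △ T) ≡ parity S xor parity T
parity-△ []      []      = refl
parity-△ (s ∷ S) (t ∷ T) = trans (cong ((s xor t) xor_) (parity-△ S T)) (xor-interchange s t (parity S) (parity T))

parity-⊥ : ∀ N → parity (⊥ {N}) ≡ false
parity-⊥ zero    = refl
parity-⊥ (suc N) = parity-⊥ N

∣S∣≡0⇒S≡⊥ : (S : Subset N) → ∣ S ∣ ≡ 0 → S ≡ ⊥
∣S∣≡0⇒S≡⊥ []            _  = refl
∣S∣≡0⇒S≡⊥ (outside ∷ S) eq = cong (outside ∷_) (∣S∣≡0⇒S≡⊥ S eq)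

∣S∣≡1⇒odd : (S : Subset N) → ∣ S ∣ ≡ 1 → parity S ≡ true
∣S∣≡1⇒odd {suc N} (inside ∷ S) eq rewrite ∣S∣≡0⇒S≡⊥ S (ℕₚ.suc-injective eq) | parity-⊥ N = refl
∣S∣≡1⇒odd (outside ∷ S) eq = ∣S∣≡1⇒odd S eq

parity-∩⁅⁆ : (S : Subset N) (e : Fin N) → parity (S ∩ ⁅ e ⁆) ≡ lookup S e
parity-∩⁅⁆ {suc N} (s ∷ S) zero
  rewrite Boolₚ.∧-identityʳ s | Subsetₚ.∩-zeroʳ S | parity-⊥ N = Boolₚ.xor-identityʳ s
parity-∩⁅⁆ (s ∷ S) (suc e) rewrite Boolₚ.∧-zeroʳ s = parity-∩⁅⁆ S e

∣∩∣+∣∩∁∣ : (S T : Subset N) → ∣ S ∩ T ∣ + ∣ S ∩ ∁ T ∣ ≡ ∣ S ∣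
∣∩∣+∣∩∁∣ []            []            = refl
∣∩∣+∣∩∁∣ (inside  ∷ S) (inside  ∷ T) = cong suc (∣∩∣+∣∩∁∣ S T)
∣∩∣+∣∩∁∣ (inside  ∷ S) (outside ∷ T) = trans (ℕₚ.+-suc _ _) (cong suc (∣∩∣+∣∩∁∣ S T))
∣∩∣+∣∩∁∣ (outside ∷ S) (t       ∷ T) = ∣∩∣+∣∩∁∣ S T

nonempty⇒∣∣>0 : {S : Subset N} → Nonempty S → 1 ≤ ∣ S ∣
nonempty⇒∣∣>0 (e , e∈S) = ℕₚ.≤-trans (s≤s z≤n) (Subsetₚ.x∈p⇒∣p-x∣<∣p∣ e∈S)

length-filter≤∣∣ : {X : Set} {P : Pred X 0ℓ} (P? : Decidable P) (f : Fin N → X) (S : Subset N) →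
                   (∀ e → P (f e) → lookup S e ≡ true) → length (filter P? (List.tabulate f)) ≤ ∣ S ∣
length-filter≤∣∣ P? f [] _ = z≤n
length-filter≤∣∣ P? f (s ∷ S) P⇒S with P? (f zero) | s | P⇒S zero
... | yes p | outside | P⇒s with P⇒s p
...   | ()
length-filter≤∣∣ P? f (s ∷ S) P⇒S | yes p | inside  | _ = s≤s (length-filter≤∣∣ P? (f ∘ suc) S (P⇒S ∘ suc))
length-filter≤∣∣ P? f (s ∷ S) P⇒S | no  _ | inside  | _ = ℕₚ.m≤n⇒m≤1+n (length-filter≤∣∣ P? (f ∘ suc) S (P⇒S ∘ suc))
length-filter≤∣∣ P? f (s ∷ S) P⇒S | no  _ | outside | _ = length-filter≤∣∣ P? (f ∘ suc) S (P⇒S ∘ suc)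

lookup-⁅⁆-same : (e : Fin N) → lookup ⁅ e ⁆ e ≡ true
lookup-⁅⁆-same e = Vecₚ.[]=⇒lookup (Subsetₚ.x∈⁅x⁆ e)

lookup-⁅⁆-other : {e f : Fin N} → f ≢ e → lookup ⁅ e ⁆ f ≡ false
lookup-⁅⁆-other {e = e} {f} f≢e with lookup ⁅ e ⁆ f in eq
... | false = refl
... | true  = contradiction (Vecₚ.lookup⇒[]= f ⁅ e ⁆ eq) (Subsetₚ.x≢y⇒x∉⁅y⁆ f≢e)

∑⁅⁆-∉ : {e : Fin N} {es : List (Fin N)} → All (e ≢_) es → lookup ∑⁅ es ⁆ e ≡ false
∑⁅⁆-∉ {e = e} [] = Vecₚ.lookup-replicate e false
∑⁅⁆-∉ {e = e} {f ∷ es} (e≢f ∷ e∉) = trans (Vecₚ.lookup-zipWith _xor_ e ⁅ f ⁆ ∑⁅ es ⁆)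
  (cong₂ _xor_ (lookup-⁅⁆-other e≢f) (∑⁅⁆-∉ e∉))

∑⁅⁆-∈ : {e : Fin N} {es : List (Fin N)} → Unique es → e List∈.∈ es → lookup ∑⁅ es ⁆ e ≡ true
∑⁅⁆-∈ {e = e} {_ ∷ es} (e∉ ∷ _) (here refl) = trans (Vecₚ.lookup-zipWith _xor_ e ⁅ e ⁆ ∑⁅ es ⁆)
  (cong₂ _xor_ (lookup-⁅⁆-same e) (∑⁅⁆-∉ e∉))
∑⁅⁆-∈ {e = e} {f ∷ es} (f∉ ∷ unique) (there e∈) = trans (Vecₚ.lookup-zipWith _xor_ e ⁅ f ⁆ ∑⁅ es ⁆)
  (cong₂ _xor_ (lookup-⁅⁆-other (λ e≡f → All.lookup f∉ e∈ (sym e≡f))) (∑⁅⁆-∈ unique e∈))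

-- Cuts and their forced parities

module GraphParity {n : ℕ} (H : Graph n) where
  open Graph H
  open Subset using (_∈_)

  -- An edge has two ends, so it meets `U` in an odd number of them exactly when it crosses the cut.
  -- Phrasing the cut by parity makes it linear over F₂, as `∂-△` records.
  ∂ : Subset n → Subset ∣E∣
  ∂ U = tabulate λ e → parity (edge e ∩ U)

  lookup-∂ : ∀ U e → lookup (∂ U) e ≡ parity (edge e ∩ U)
  lookup-∂ U e = Vecₚ.lookup∘tabulate _ e

  ∂-△ : ∀ U V → ∂ (U △ V) ≡ ∂ U △ ∂ V
  ∂-△ U V = lookup-ext λ e → begin
    lookup (∂ (U △ V)) e                        ≡⟨ lookup-∂ (U △ V) e ⟩
    parity (edge e ∩ (U △ V))                   ≡⟨ cong parity (Vecₚ.zipWith-distribˡ Boolₚ.∧-distribˡ-xor (edge e) U V) ⟩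
    parity ((edge e ∩ U) △ (edge e ∩ V))        ≡⟨ parity-△ (edge e ∩ U) (edge e ∩ V) ⟩
    parity (edge e ∩ U) xor parity (edge e ∩ V) ≡⟨ sym (cong₂ _xor_ (lookup-∂ U e) (lookup-∂ V e)) ⟩
    lookup (∂ U) e xor lookup (∂ V) e           ≡⟨ sym (Vecₚ.lookup-zipWith _xor_ e (∂ U) (∂ V)) ⟩
    lookup (∂ U △ ∂ V) e                        ∎
    where open ≡-Reasoning

  ∂-⊥ : ∂ ⊥ ≡ ⊥
  ∂-⊥ = lookup-ext λ e → trans (lookup-∂ ⊥ e)
    (trans (cong parity (Subsetₚ.∩-zeroʳ (edge e))) (trans (parity-⊥ n) (sym (Vecₚ.lookup-replicate e false))))

  -- The star of a vertex is the cut around it, so the Tseitin constraints are instances of cut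
  -- parities.
  ∂-⁅⁆ : ∀ u → ∂ ⁅ u ⁆ ≡ ∑⁅ incident u ⁆
  ∂-⁅⁆ u = lookup-ext λ e → trans (lookup-∂ ⁅ u ⁆ e) (trans (parity-∩⁅⁆ (edge e) u) (sym (value e)))
    where
    value : ∀ e → lookup ∑⁅ incident u ⁆ e ≡ lookup (edge e) u
    value e with lookup (edge e) u in eq
    ... | true  = ∑⁅⁆-∈ (Uniqueₚ.filter⁺ (λ e → u ∈? edge e) (Uniqueₚ.allFin⁺ ∣E∣))
                   (List∈ₚ.∈-filter⁺ (λ e → u ∈? edge e) (List∈ₚ.∈-allFin e) (Vecₚ.lookup⇒[]= u (edge e) eq))
    ... | false = ∑⁅⁆-∉ (All.tabulate λ f∈ e≡f → u∉ (subst (λ f → u ∈ edge f) (sym e≡f)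
                   (proj₂ (List∈ₚ.∈-filter⁻ (λ e → u ∈? edge e) {xs = allFin ∣E∣} f∈))))
      where
      u∉ : ¬ u ∈ edge e
      u∉ u∈ with trans (sym eq) (Vecₚ.[]=⇒lookup u∈)
      ... | ()

  leaving≤∂ : ∀ U → length (leaving U) ≤ ∣ ∂ U ∣
  leaving≤∂ U = length-filter≤∣∣ _ id (∂ U) λ e (inU , outU) →
    trans (lookup-∂ U e) (∣S∣≡1⇒odd (edge e ∩ U) (one _ _ (nonempty⇒∣∣>0 inU) (nonempty⇒∣∣>0 outU)
      (trans (∣∩∣+∣∩∁∣ (edge e) U) (edge-size e))))
    where
    one : ∀ a b → 1 ≤ a → 1 ≤ b → a + b ≡ 2 → a ≡ 1
    one 1             _       _ _ _  = refl
    one (suc (suc a)) (suc b) _ _ eq with trans (sym (ℕₚ.+-suc a b)) (ℕₚ.suc-injective (ℕₚ.suc-injective eq))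
    ... | ()

  2∣E∣≤ : ∀ d → (∀ u → degree u ≤ d) → 2 * ∣E∣ ≤ n * d
  2∣E∣≤ d degree≤d = begin
    2 * ∣E∣                                      ≡⟨ cong (2 *_) {∣E∣} {length (allFin ∣E∣)} (sym (Listₚ.length-tabulate id)) ⟩
    2 * length (allFin ∣E∣)                      ≡⟨ sym (twos (allFin ∣E∣)) ⟩
    sum (map (λ e → ∣ edge e ∣) (allFin ∣E∣))    ≡⟨ sym (ℕₚ.*-identityˡ _) ⟩
    1 * sum (map (λ e → ∣ edge e ∣) (allFin ∣E∣)) ≤⟨ ∑∣∣≤ 1 d edge (allFin ∣E∣) (λ u →
        ℕₚ.≤-trans (ℕₚ.≤-reflexive (ℕₚ.*-identityˡ _)) (degree≤d u)) ⟩
    n * d ∎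
    where
    open ℕₚ.≤-Reasoning
    twos : ∀ es → sum (map (λ e → ∣ edge e ∣) es) ≡ 2 * length es
    twos []       = refl
    twos (e ∷ es) = trans (cong₂ _+_ (edge-size e) (twos es)) (sym (ℕₚ.*-suc 2 (length es)))

  module Expanding (A : ℕ) (expanding : ∀ U → 2 * ∣ U ∣ ≤ n → ∣ U ∣ ≤ A * ∣ ∂ U ∣) where

    private
      -- A vertex set and its complement have the same cut, and for odd `n` their sizes have
      -- opposite parities; taking the smaller side is what makes the parity meaningful.
      IsSource : Subset ∣E∣ → Subset n → Set
      IsSource S U = 2 * ∣ U ∣ ≤ n × ∂ U ≡ S

      source? : ∀ S → Dec (∃[ U ] IsSource S U)
      source? S = anySubset? λ U → (2 * ∣ U ∣ ℕ.≤? n) ×-dec Vecₚ.≡-dec Boolₚ._≟_ (∂ U) S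

    -- Summing the constraints at the vertices of U shows that the edges
    -- leaving U have total parity ∣ U ∣.
    cutParity : Subset ∣E∣ → Maybe Bool
    cutParity S with source? S
    ... | yes (U , _) = just (parity U)
    ... | no  _       = nothing

    module _ (W : ℕ) (6AW≤n : 6 * (A * W) ≤ n) where

      private
        cutParity⁻ : ∀ {S a} → ∣ S ∣ ≤ W → cutParity S ≡ just a → ∃[ U ] (∂ U ≡ S × ∣ U ∣ ≤ A * W × parity U ≡ a)
        cutParity⁻ {S} S≤ eq with source? S
        cutParity⁻ {S} S≤ refl | yes (U , small , refl) =
          U , refl , ℕₚ.≤-trans (expanding U small) (ℕₚ.*-monoʳ-≤ A S≤) , refl

        -- The set `V` found by the search need not be `U`, but V △ U has an empty cut. Expansion
        -- bounds `V` by A W vertices, and `U` may have 2 A W since it arises as a sum of two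
        -- sources in `cutParity-isPC`. Hence V △ U has at most 3 A W ≤ n / 2 vertices, and
        -- expansion makes it empty.
        cutParity⁺ : ∀ U → ∣ ∂ U ∣ ≤ W → ∣ U ∣ ≤ 2 * (A * W) → cutParity (∂ U) ≡ just (parity U)
        cutParity⁺ U ∂U≤ U≤ with source? (∂ U)
        ... | no none = contradiction (U , (begin
            2 * ∣ U ∣              ≤⟨ ℕₚ.*-monoʳ-≤ 2 U≤ ⟩
            2 * (2 * (A * W))      ≡⟨ sym (ℕₚ.*-assoc 2 2 (A * W)) ⟩
            4 * (A * W)            ≤⟨ ℕₚ.*-monoˡ-≤ (A * W) {4} {6} (s≤s (s≤s (s≤s (s≤s z≤n)))) ⟩
            6 * (A * W)            ≤⟨ 6AW≤n ⟩
            n ∎) , refl) none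
          where open ℕₚ.≤-Reasoning
        ... | yes (V , small , ∂V≡∂U) = cong just (begin
            parity V                       ≡⟨ cong parity (sym (△-cancelʳ V U)) ⟩
            parity ((V △ U) △ U)           ≡⟨ cong (λ D → parity (D △ U)) V△U≡⊥ ⟩
            parity (⊥ △ U)                 ≡⟨ cong parity (△-identityˡ U) ⟩
            parity U ∎)
          where
          open ≡-Reasoning
          ∂≡⊥ : ∂ (V △ U) ≡ ⊥
          ∂≡⊥ = trans (∂-△ V U) (trans (cong (_△ ∂ U) ∂V≡∂U) (△-self (∂ U)))
          V≤ : ∣ V ∣ ≤ A * W
          V≤ = ℕₚ.≤-trans (expanding V small) (ℕₚ.*-monoʳ-≤ A (ℕₚ.≤-trans (ℕₚ.≤-reflexive (cong ∣_∣ ∂V≡∂U)) ∂U≤))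
          V△U-small : 2 * ∣ V △ U ∣ ≤ n
          V△U-small = ℕₚ.≤-trans (ℕₚ.*-monoʳ-≤ 2 (ℕₚ.≤-trans (∣△∣≤ V U) (ℕₚ.+-mono-≤ V≤ U≤)))
            (ℕₚ.≤-trans (ℕₚ.≤-reflexive (sym (ℕₚ.*-assoc 2 3 (A * W)))) 6AW≤n)
          V△U≡⊥ : V △ U ≡ ⊥
          V△U≡⊥ = ∣S∣≡0⇒S≡⊥ (V △ U) (ℕₚ.n≤0⇒n≡0 (ℕₚ.≤-trans (expanding (V △ U) V△U-small)
            (ℕₚ.≤-reflexive (trans (cong (A *_) (trans (cong ∣_∣ ∂≡⊥) (Subsetₚ.∣⊥∣≡0 ∣E∣))) (ℕₚ.*-zeroʳ A)))))

      cutParity-isPC : IsPseudoCharacter W cutParity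
      cutParity-isPC = record { K-⊥ = K-⊥ ; K-△ = K-△ }
        where
        open ≡-Reasoning
        K-⊥ : cutParity ⊥ ≡ just false
        K-⊥ = begin
          cutParity ⊥      ≡⟨ cong cutParity (sym ∂-⊥) ⟩
          cutParity (∂ ⊥)  ≡⟨ cutParity⁺ ⊥ (ℕₚ.≤-trans (ℕₚ.≤-reflexive (cong ∣_∣ ∂-⊥)) (∣⊥∣≤ {∣E∣})) (∣⊥∣≤ {n}) ⟩
          just (parity (⊥ {n})) ≡⟨ cong just (parity-⊥ n) ⟩
          just false       ∎
        K-△ : ∀ {S T a b} → ∣ S ∣ ≤ W → ∣ T ∣ ≤ W → ∣ S △ T ∣ ≤ W →
              cutParity S ≡ just a → cutParity T ≡ just b → cutParity (S △ T) ≡ just (a xor b)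
        K-△ {S} {T} S≤ T≤ ST≤ KS KT
          with U , refl , U≤ , refl ← cutParity⁻ {S} S≤ KS | V , refl , V≤ , refl ← cutParity⁻ {T} T≤ KT = begin
          cutParity (∂ U △ ∂ V)        ≡⟨ cong cutParity (sym (∂-△ U V)) ⟩
          cutParity (∂ (U △ V))        ≡⟨ cutParity⁺ (U △ V) (subst (λ X → ∣ X ∣ ≤ W) (sym (∂-△ U V)) ST≤)
                                            (ℕₚ.≤-trans (∣△∣≤ U V) (ℕₚ.≤-trans (ℕₚ.+-mono-≤ U≤ V≤)
                                              (ℕₚ.≤-reflexive (cong (A * W +_) (sym (ℕₚ.+-identityʳ (A * W))))))) ⟩
          just (parity (U △ V))        ≡⟨ cong just (parity-△ U V) ⟩
          just (parity U xor parity V) ∎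

      cutParity-incident : 1 ≤ A * W → ∀ u → degree u ≤ W → cutParity ∑⁅ incident u ⁆ ≡ just true
      cutParity-incident 1≤AW u degree≤W = begin
        cutParity ∑⁅ incident u ⁆   ≡⟨ cong cutParity (sym (∂-⁅⁆ u)) ⟩
        cutParity (∂ ⁅ u ⁆)         ≡⟨ cutParity⁺ ⁅ u ⁆ (ℕₚ.≤-trans (ℕₚ.≤-reflexive (cong ∣_∣ (∂-⁅⁆ u)))
                                         (ℕₚ.≤-trans (∣∑⁅⁆∣≤ (incident u)) degree≤W))
                                         (ℕₚ.≤-trans (ℕₚ.≤-reflexive (Subsetₚ.∣⁅x⁆∣≡1 u)) (ℕₚ.≤-trans 1≤AW (ℕₚ.m≤m+n (A * W) _))) ⟩
        just (parity ⁅ u ⁆)         ≡⟨ cong just (∣S∣≡1⇒odd ⁅ u ⁆ (Subsetₚ.∣⁅x⁆∣≡1 u)) ⟩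
        just true                   ∎
        where open ≡-Reasoning

    size-lower-bound : ∀ d q j → 1 ≤ A → 1 ≤ q → 1 ≤ j → d ≤ q → (∀ u → degree u ≤ d) →
                       2 * ∣E∣ ≤ q * (j * q) → 18 * A * q * j ≤ n →
                       (Π : Refutation (TS H)) → 2 ^ j ≤ monomialSize Π
    size-lower-bound d q j 1≤A 1≤q 1≤j d≤q degree≤d 2E≤ ≤n Π = ℕₚ.≮⇒≥ λ small →
      let K , K-isPC , cutParity⊑K , light = elimination j cutParity (cutParity-isPC W 6AW≤n)
            (subst (ℕ._< 2 ^ j) (sym (length-monomials Π)) small)
      in Tseitin.not-all-light H K w K-isPC degree≤w
           (λ u → cutParity⊑K (cutParity-incident W 6AW≤n (ℕₚ.*-mono-≤ 1≤A 1≤W) u (ℕₚ.≤-trans (degree≤w u) (ℕₚ.m≤m+n w _))))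
           Π light
      where
      w = j * q
      -- The first `w` pays for the `j * q` assignments; the pair `w + w` is the width left for the
      -- functional.
      W = w + (w + w)
      1≤W : 1 ≤ W
      1≤W = ℕₚ.≤-trans (ℕₚ.*-mono-≤ 1≤j 1≤q) (ℕₚ.m≤m+n w _)
      degree≤w : ∀ u → degree u ≤ w
      degree≤w u = ℕₚ.≤-trans (degree≤d u) (ℕₚ.≤-trans d≤q (ℕₚ.≤-trans (ℕₚ.≤-reflexive (sym (ℕₚ.*-identityˡ q))) (ℕₚ.*-monoˡ-≤ q 1≤j)))
      open Elimination q w 1≤q 2E≤ (monomials Π)
      6AW≤n : 6 * (A * W) ≤ n
      6AW≤n = ℕₚ.≤-trans (ℕₚ.≤-reflexive (solve 3 (λ A q j → con 6 :* (A :* (j :* q :+ (j :* q :+ j :* q))) := con 18 :* A :* q :* j) refl A q j)) ≤n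
        where open ℕ-Solver.+-*-Solver

-- Reals

private
  ι : ℕ → ℚ
  ι m = ℤ.+ m ℚ./ 1

  ιᵘ : ℕ → ℚᵘ.ℚᵘ
  ιᵘ m = ℚᵘ.mkℚᵘ (ℤ.+ m) 0

  toℚᵘ-ι : ∀ m → ℚ.toℚᵘ (ι m) ℚᵘ.≃ ιᵘ m
  toℚᵘ-ι m = ℚₚ.toℚᵘ-fromℚᵘ (ιᵘ m)

  ι-+ : ∀ m n → ι (m + n) ≡ ι m ℚ.+ ι n
  ι-+ m n = ℚₚ.toℚᵘ-injective (begin
    ℚ.toℚᵘ (ι (m + n))                ≈⟨ toℚᵘ-ι (m + n) ⟩
    ιᵘ (m + n)                        ≈⟨ ℚᵘ.*≡* (solve 2 (λ x y → (x :+ y) :* con (ℤ.+ 1) := (x :* con (ℤ.+ 1) :+ y :* con (ℤ.+ 1)) :* con (ℤ.+ 1)) refl (ℤ.+ m) (ℤ.+ n)) ⟩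
    ιᵘ m ℚᵘ.+ ιᵘ n                    ≈⟨ ℚᵘₚ.≃-sym (ℚᵘₚ.+-cong (toℚᵘ-ι m) (toℚᵘ-ι n)) ⟩
    ℚ.toℚᵘ (ι m) ℚᵘ.+ ℚ.toℚᵘ (ι n)    ≈⟨ ℚᵘₚ.≃-sym (ℚₚ.toℚᵘ-homo-+ (ι m) (ι n)) ⟩
    ℚ.toℚᵘ (ι m ℚ.+ ι n)              ∎)
    where
    open ℚᵘₚ.≃-Reasoning
    open ℤ-Solver.+-*-Solver

  ι-* : ∀ m n → ι (m * n) ≡ ι m ℚ.* ι n
  ι-* m n = ℚₚ.toℚᵘ-injective (begin
    ℚ.toℚᵘ (ι (m * n))                ≈⟨ toℚᵘ-ι (m * n) ⟩
    ιᵘ (m * n)                        ≈⟨ ℚᵘ.*≡* (cong (ℤ._* ℤ.+ 1) (ℤₚ.pos-* m n)) ⟩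
    ιᵘ m ℚᵘ.* ιᵘ n                    ≈⟨ ℚᵘₚ.≃-sym (ℚᵘₚ.*-cong (toℚᵘ-ι m) (toℚᵘ-ι n)) ⟩
    ℚ.toℚᵘ (ι m) ℚᵘ.* ℚ.toℚᵘ (ι n)    ≈⟨ ℚᵘₚ.≃-sym (ℚₚ.toℚᵘ-homo-* (ι m) (ι n)) ⟩
    ℚ.toℚᵘ (ι m ℚ.* ι n)              ∎)
    where open ℚᵘₚ.≃-Reasoning

  ι-≥0 : ∀ m → ℚ.NonNegative (ι m)
  ι-≥0 m = ℚₚ.normalize-nonNeg m 1

  ι-mono-≤ : ∀ {m n} → m ≤ n → ι m ℚ.≤ ι n
  ι-mono-≤ {m} m≤n with k , refl ← ℕₚ.m≤n⇒∃[o]m+o≡n m≤n = begin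
    ι m             ≡⟨ sym (ℚₚ.+-identityʳ (ι m)) ⟩
    ι m ℚ.+ 0ℚ      ≤⟨ ℚₚ.+-monoʳ-≤ (ι m) (ℚₚ.nonNegative⁻¹ (ι k) {{ι-≥0 k}}) ⟩
    ι m ℚ.+ ι k     ≡⟨ sym (ι-+ m k) ⟩
    ι (m + k)       ∎
    where open ℚₚ.≤-Reasoning

  ι>0 : ∀ {m} → 1 ≤ m → ℚ.Positive (ι m)
  ι>0 1≤m = ℚ.positive (ℚₚ.<-≤-trans (ℚₚ.positive⁻¹ 1ℚ) (ι-mono-≤ 1≤m))

  -- The denominator of `ε` serves as `A`: the product is the numerator, a positive integer.
  archimedean : ∀ ε → 0ℚ ℚ.< ε → ∃[ A ] (1 ≤ A × 1ℚ ℚ.≤ ε ℚ.* ι A)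
  archimedean ε@(ℚ.mkℚ ℤ.+[1+ k ] d-1 _) _ = suc d-1 , s≤s z≤n , ℚₚ.toℚᵘ-cancel-≤ (begin
    ℚ.toℚᵘ 1ℚ                              ≤⟨ ℚᵘ.*≤* (ℤ.+≤+ bound) ⟩
    ℚ.toℚᵘ ε ℚᵘ.* ιᵘ (suc d-1)             ≃⟨ ℚᵘₚ.≃-sym (ℚᵘₚ.*-congˡ {ℚ.toℚᵘ ε} (toℚᵘ-ι (suc d-1))) ⟩
    ℚ.toℚᵘ ε ℚᵘ.* ℚ.toℚᵘ (ι (suc d-1))     ≃⟨ ℚᵘₚ.≃-sym (ℚₚ.toℚᵘ-homo-* ε (ι (suc d-1))) ⟩
    ℚ.toℚᵘ (ε ℚ.* ι (suc d-1))             ∎)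
    where
    open ℚᵘₚ.≤-Reasoning
    bound : 1 * (suc d-1 * 1) ≤ suc k * suc d-1 * 1
    bound = ℕₚ.≤-trans (ℕₚ.≤-reflexive (sym (ℕₚ.*-assoc 1 (suc d-1) 1)))
      (ℕₚ.*-monoˡ-≤ 1 (ℕₚ.*-monoˡ-≤ (suc d-1) {1} {suc k} (s≤s z≤n)))
  archimedean (ℚ.mkℚ (ℤ.+ 0) d-1 _) 0<ε with ℚₚ.drop-*<* 0<ε
  ... | ℤ.+<+ ()
  archimedean (ℚ.mkℚ ℤ.-[1+ k ] d-1 _) 0<ε with ℚₚ.drop-*<* 0<ε
  ... | ()

-- As `≤ᴿ` is a negation, a gap has to be refuted: if A l < u, then l + ε ≤ ε (1 + A l) ≤ ε u < α u
-- at all late indices. The real constant is thereby traded for a natural number.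
expansion-bound : (α : ℝ) → 0ᴿ <ᴿ α →
                  ∃[ A ] (1 ≤ A × (∀ u l → α *ᴿ fromℕ u ≤ᴿ fromℕ l → u ≤ A * l))
expansion-bound α (ε , ε>0 , N , ε<α) with archimedean ε ε>0
... | A , 1≤A , 1≤εA = A , 1≤A , λ u l αu≤l → ℕₚ.≮⇒≥ λ Al<u → αu≤l (ε , ε>0 , N , λ i N≤i → begin-strict
  ι l ℚ.+ ε                               ≡⟨ solve 2 (λ l ε → l :+ ε := con 1ℚ :* l :+ ε) refl (ι l) ε ⟩
  1ℚ ℚ.* ι l ℚ.+ ε                        ≤⟨ ℚₚ.+-monoˡ-≤ ε (ℚₚ.*-monoʳ-≤-nonNeg (ι l) {{ι-≥0 l}} 1≤εA) ⟩
  ε ℚ.* ι A ℚ.* ι l ℚ.+ ε                 ≡⟨ solve 3 (λ ε A l → ε :* A :* l :+ ε := ε :* (con 1ℚ :+ A :* l)) refl ε (ι A) (ι l) ⟩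
  ε ℚ.* (1ℚ ℚ.+ ι A ℚ.* ι l)              ≡⟨ cong (ε ℚ.*_) (sym (trans (ι-+ 1 (A * l)) (cong (1ℚ ℚ.+_) (ι-* A l)))) ⟩
  ε ℚ.* ι (suc (A * l))                   ≤⟨ ℚₚ.*-monoˡ-≤-nonNeg ε {{ℚₚ.pos⇒nonNeg ε {{ℚ.positive ε>0}}}} (ι-mono-≤ Al<u) ⟩
  ε ℚ.* ι u                               <⟨ ℚₚ.*-monoˡ-<-pos (ι u) {{ι>0 (ℕₚ.≤-trans (s≤s z≤n) Al<u)}}
                                               (subst (ℚ._< seq α i) (ℚₚ.+-identityˡ ε) (ε<α i N≤i)) ⟩
  seq α i ℚ.* ι u                         ∎)
  where
  open ℚₚ.≤-Reasoning
  open +-*-Solver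

-- For ε = 1 / D the bound n ≤ D j says ε n ≤ j. The test a < c + b ε n then gives a ≤ c + b j, and
-- so 2^a ≤ 2^c (2^j)^b ≤ 2^c s^b.
reciprocal : ∀ D → 1 ≤ D → ∃[ ε ] (0ᴿ <ᴿ ε ×
             (∀ n j s → n ≤ D * j → 2 ^ j ≤ s → 2^ ε *ᴿ fromℕ n ≤ s))
-- `<ᴿ` demands a margin that is still strictly below `ε`, hence the half.
reciprocal D 1≤D = fromℚ ε , (½ ℚ.* ε , ½ε>0 , 0 , λ _ _ → half) , exponent
  where
  open ℚₚ.≤-Reasoning
  instance
    D⁺ : ℚ.Positive (ι D)
    D⁺ = ι>0 1≤D
    D≢0 : ℚ.NonZero (ι D)
    D≢0 = ℚₚ.pos⇒nonZero (ι D)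
  ε = ℚ.1/ ι D
  ε⁺ : ℚ.Positive ε
  ε⁺ = ℚₚ.1/pos⇒pos (ι D)
  ½ε⁺ : ℚ.Positive (½ ℚ.* ε)
  ½ε⁺ = ℚₚ.pos*pos⇒pos ½ ε {{ε⁺}}
  ½ε>0 : 0ℚ ℚ.< ½ ℚ.* ε
  ½ε>0 = ℚₚ.positive⁻¹ (½ ℚ.* ε) {{½ε⁺}}
  half : 0ℚ ℚ.+ ½ ℚ.* ε ℚ.< ε
  half = begin-strict
    0ℚ ℚ.+ ½ ℚ.* ε           <⟨ ℚₚ.+-monoˡ-< (½ ℚ.* ε) ½ε>0 ⟩
    ½ ℚ.* ε ℚ.+ ½ ℚ.* ε     ≡⟨ solve 1 (λ e → con ½ :* e :+ con ½ :* e := e) refl ε ⟩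
    ε                         ∎
    where open +-*-Solver
  exponent : ∀ n j s → n ≤ D * j → 2 ^ j ≤ s → 2^ fromℚ ε *ᴿ fromℕ n ≤ s
  exponent n j s n≤Dj 2^j≤s a b c _ (η , η>0 , N , below) = bound
    where
    εn≤j : ε ℚ.* ι n ℚ.≤ ι j
    εn≤j = begin
      ε ℚ.* ι n            ≤⟨ ℚₚ.*-monoˡ-≤-nonNeg ε {{ℚₚ.pos⇒nonNeg ε {{ε⁺}}}} (ι-mono-≤ n≤Dj) ⟩
      ε ℚ.* ι (D * j)      ≡⟨ cong (ε ℚ.*_) (ι-* D j) ⟩
      ε ℚ.* (ι D ℚ.* ι j)  ≡⟨ sym (ℚₚ.*-assoc ε (ι D) (ι j)) ⟩
      ε ℚ.* ι D ℚ.* ι j    ≡⟨ cong (ℚ._* ι j) (ℚₚ.*-inverseˡ (ι D)) ⟩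
      1ℚ ℚ.* ι j           ≡⟨ ℚₚ.*-identityˡ (ι j) ⟩
      ι j                  ∎
    ιa<ι : ι a ℚ.< ι (c + b * j)
    ιa<ι = begin-strict
      ι a                            ≡⟨ sym (ℚₚ.+-identityʳ (ι a)) ⟩
      ι a ℚ.+ 0ℚ                     <⟨ ℚₚ.+-monoʳ-< (ι a) η>0 ⟩
      ι a ℚ.+ η                      <⟨ below N ℕₚ.≤-refl ⟩
      ι c ℚ.+ ι b ℚ.* (ε ℚ.* ι n)    ≤⟨ ℚₚ.+-monoʳ-≤ (ι c) (ℚₚ.*-monoˡ-≤-nonNeg (ι b) {{ι-≥0 b}} εn≤j) ⟩
      ι c ℚ.+ ι b ℚ.* ι j            ≡⟨ sym (trans (ι-+ c (b * j)) (cong (ι c ℚ.+_) (ι-* b j))) ⟩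
      ι (c + b * j)                  ∎
    a≤ : a ≤ c + b * j
    a≤ = ℕₚ.≮⇒≥ λ lt → ℚₚ.<-irrefl refl (ℚₚ.<-≤-trans ιa<ι (ι-mono-≤ (ℕₚ.<⇒≤ lt)))
    bound : 2 ^ a ≤ 2 ^ c * s ^ b
    bound = ℕₚ.≤-trans (ℕₚ.^-monoʳ-≤ 2 a≤) (ℕₚ.≤-trans
      (ℕₚ.≤-reflexive (trans (ℕₚ.^-distribˡ-+-* 2 c (b * j))
        (cong (2 ^ c *_) (trans (cong (2 ^_) (ℕₚ.*-comm b j)) (sym (ℕₚ.^-*-assoc 2 j b))))))
      (ℕₚ.*-monoʳ-≤ (2 ^ c) (ℕₚ.^-monoˡ-≤ b 2^j≤s)))

-- Write j = n / M.  For c = 18, M j ≤ n says 6 A W ≤ n with W = 3 j q, and the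
-- factor 2 c (d + 1) A of q makes n d ≤ 2 M j d at most q (j q).
module Parameters (c A d : ℕ) (1≤c : 1 ≤ c) (1≤A : 1 ≤ A) where

  open ℕₚ.≤-Reasoning

  q M : ℕ
  q = 2 * c * suc d * A
  M = c * A * q

  1≤q : 1 ≤ q
  1≤q = ℕₚ.*-mono-≤ {1} {2 * c * suc d} {1} {A} (ℕₚ.*-mono-≤ {1} {2 * c} {1} {suc d} (ℕₚ.*-mono-≤ {1} {2} {1} {c} (s≤s z≤n) 1≤c) (s≤s z≤n)) 1≤A

  1≤M : 1 ≤ M
  1≤M = ℕₚ.*-mono-≤ {1} {c * A} {1} {q} (ℕₚ.*-mono-≤ {1} {c} {1} {A} 1≤c 1≤A) 1≤q

  instance
    M≢0 : ℕ.NonZero M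
    M≢0 = ℕ.>-nonZero 1≤M

  d≤q : d ≤ q
  d≤q = begin
    d                    ≤⟨ ℕₚ.n≤1+n d ⟩
    suc d                ≡⟨ sym (trans (ℕₚ.*-identityʳ (1 * suc d)) (ℕₚ.*-identityˡ (suc d))) ⟩
    1 * suc d * 1        ≤⟨ ℕₚ.*-mono-≤ {1 * suc d} {2 * c * suc d} {1} {A} (ℕₚ.*-monoˡ-≤ (suc d) {1} {2 * c} (ℕₚ.*-mono-≤ {1} {2} {1} {c} (s≤s z≤n) 1≤c)) 1≤A ⟩
    2 * c * suc d * A    ∎

  module _ {n : ℕ} (M≤n : M ≤ n) where

    1≤j : 1 ≤ n / M
    1≤j = m≥n⇒m/n>0 M≤n

    Mj≤n : M * (n / M) ≤ n
    Mj≤n = ℕₚ.≤-trans (ℕₚ.≤-reflexive (ℕₚ.*-comm M (n / M))) (m/n*n≤m n M)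

    -- The remainder is less than M, hence at most M j because j ≥ 1. Rounding down thus costs a
    -- factor 2 in the exponent.
    n≤2Mj : n ≤ 2 * M * (n / M)
    n≤2Mj = begin
      n                              ≡⟨ m≡m%n+[m/n]*n n M ⟩
      n ℕ.% M + n / M * M            ≤⟨ ℕₚ.+-monoˡ-≤ (n / M * M) (ℕₚ.<⇒≤ (m%n<n n M)) ⟩
      M + n / M * M                  ≡⟨ cong (_+ n / M * M) (sym (ℕₚ.*-identityˡ M)) ⟩
      1 * M + n / M * M              ≤⟨ ℕₚ.+-monoˡ-≤ (n / M * M) (ℕₚ.*-monoˡ-≤ M {1} {n / M} 1≤j) ⟩
      n / M * M + n / M * M          ≡⟨ double (n / M) M ⟩
      2 * M * (n / M)                ∎
      where
      double : ∀ j M → j * M + j * M ≡ 2 * M * j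
      double = solve 2 (λ j M → j :* M :+ j :* M := con 2 :* M :* j) refl
        where open ℕ-Solver.+-*-Solver

    nd≤qjq : n * d ≤ q * (n / M * q)
    nd≤qjq = begin
      n * d                          ≤⟨ ℕₚ.*-mono-≤ {n} {2 * M * (n / M)} {d} {suc d} n≤2Mj (ℕₚ.n≤1+n d) ⟩
      2 * M * (n / M) * suc d        ≡⟨ regroup c A q (n / M) (suc d) ⟩
      q * (n / M * q)                ∎
      where
      regroup : ∀ c A q j d → 2 * (c * A * q) * j * d ≡ q * (j * (2 * c * d * A))
      regroup = solve 5 (λ c A q j d → con 2 :* (c :* A :* q) :* j :* d := q :* (j :* (con 2 :* c :* d :* A))) refl
        where open ℕ-Solver.+-*-Solver

open import Relation.Unary using (_∈_)

-- The exponential bound for an expander family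

module Family (F : ExpanderFamily) where
  open ExpanderFamily F

  private
    expansion : ∃[ A ] (1 ≤ A × (∀ u l → α *ᴿ fromℕ u ≤ᴿ fromℕ l → u ≤ A * l))
    expansion = expansion-bound α 0<α

    A : ℕ
    A = proj₁ expansion

    1≤A : 1 ≤ A
    1≤A = proj₁ (proj₂ expansion)

  open Parameters 18 A d (s≤s z≤n) 1≤A

  lower-bound : ∀ n → M ≤ n → n ∈ I → (Π : Refutation (TS (G n))) → 2 ^ (n / M) ≤ monomialSize Π
  lower-bound n M≤n n∈I = size-lower-bound d q (n / M) 1≤A 1≤q (1≤j M≤n) d≤q degree≤d
    (ℕₚ.≤-trans (2∣E∣≤ d degree≤d) (nd≤qjq M≤n)) (Mj≤n M≤n)
    where
    open GraphParity (G n)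
    expanding : ∀ U → 2 * ∣ U ∣ ≤ n → ∣ U ∣ ≤ A * ∣ ∂ U ∣
    expanding U small = ℕₚ.≤-trans
      (proj₂ (proj₂ expansion) ∣ U ∣ (length (Graph.leaving (G n) U)) (expands n n∈I U small))
      (ℕₚ.*-monoʳ-≤ A (leaving≤∂ U))
    open Expanding A expanding
    degree≤d : ∀ u → Graph.degree (G n) u ≤ d
    degree≤d u = ℕₚ.≤-reflexive (regular n n∈I u)

  exponent : ∃[ ε ] (0ᴿ <ᴿ ε × (∀ n j s → n ≤ 2 * M * j → 2 ^ j ≤ s → 2^ ε *ᴿ fromℕ n ≤ s))
  exponent = reciprocal (2 * M) (ℕₚ.*-mono-≤ {1} {2} {1} {M} (s≤s z≤n) 1≤M)

  exponential : ∀ n → M ≤ n → n ∈ I → (Π : Refutation (TS (G n))) → 2^ proj₁ exponent *ᴿ fromℕ n ≤ monomialSize Π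
  exponential n M≤n n∈I Π = proj₂ (proj₂ exponent) n (n / M) (monomialSize Π) (n≤2Mj M≤n) (lower-bound n M≤n n∈I Π)

corollary2 : (F : ExpanderFamily) → let open ExpanderFamily F in
    ∃[ ε ] (0ᴿ <ᴿ ε × (∃[ n₀ ] (∀ n → n₀ ≤ n → n ∈ I →
    (Π : Refutation (TS (G n))) → 2^ ε *ᴿ fromℕ n ≤ monomialSize Π)))
-- The threshold n₀, left to unification, is the modulus `M` of `Parameters`: from there on n / M is
-- at least 1.
corollary2 F = proj₁ exponent , proj₁ (proj₂ exponent) , _ , exponential
  where open Family F
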